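{- For any $f\in\mathbf{B}_{k,n}$, any $P\in\mathcal{P}_{k,n}$ and any reduced word $\mathbf f$ for $f$, there is a bijection $$\phi_{\mathbf f}:\widetilde{\operatorname{Deo}}_{f,P}\to\operatorname{Deo}_{f,P}$$ from the set of anti-distinguished $(f,P)$-affine Deograms to the set of (distinguished) $(f,P)$-affine Deograms.
   Context: Let $n\ge 1$, $0\le k\le n$. An $n$-periodic affine permutation is a bijection $f:\mathbb{Z}\to\mathbb{Z}$ with $f(i+n)=f(i)+n$ for all $i$. $\mathbf{B}_{k,n}$ is the set of those with $\frac1n\sum_{i=1}^n(f(i)-i)=k$ and $i\le f(i)\le i+n$ for all $i$. A reduced word for $f$ is a reduced word in the simple transpositions $s_0,\dots,s_{n-1}$ for the element of the affine Weyl group of type $\tilde A_{n-1}$ (affine permutations with $\sum_{i=1}^n(f(i)-i)=0$) obtained from $f$ by composing with the shift $i\mapsto i-k$. Lattice paths: $\mathcal{P}_{k,n}$ is the set of lattice paths $P$ from $(0,0)$ to $(n-k,k)$ with unit steps $P_1,\dots,P_n\in\{\mathrm R,\mathrm U\}$ (right, up). Extend $P$ to a bi-infinite path with steps indexed by $\mathbb{Z}$ via $P_{i+n}=P_i$ (step $1$ starts at $(0,0)$); it is invariant under translation by $(n-k,k)$. The strip of $P$ is the region between the extended path $P$ (southern boundary) and its translate $P+(0,k)$ (northern boundary). On each boundary the unit edges are labeled by $\mathbb{Z}$: the southern edge labeled $i$ is step $i$ of $P$, and the northern edge labeled $i$ is its translate by $(0,k)$. Fillings: a periodic filling assigns to each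 unit box of the strip a crossing or an elbow, invariantly under translation by $(n-k,k)$. Strands enter at the northern boundary edges and travel right/down: in a crossing box a strand entering from the left exits right and one entering from the top exits at the bottom; in an elbow box a strand entering from the left exits at the bottom and one entering from the top exits right. Each strand ends at a southern boundary edge; the strand permutation sends $i$ to $j$ if the strand entering at northern edge $i$ exits at southern edge $j$. (If $k\in\{0,n\}$ the strip has no boxes and each strand exits at the edge where it enters.) $\operatorname{Deo}_{f,P}$ is the set of periodic fillings with strand permutation $f$ that are distinguished: whenever two strands form an elbow in a box, they have crossed each other an even number of times in boxes traversed before it (counting from the northern boundary). $\widetilde{\operatorname{Deo}}_{f,P}$ is the set of periodic fillings with strand permutation $f$ that are anti-distinguished: whenever two strands form an elbow in a box, they cross each other an even number of times in boxes traversed after it (i.e. the same condition counted from the southern boundary). -}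

module Defs where

open import Data.Bool using (if_then_else_)
open import Data.Fin using (Fin; toℕ; fromℕ<)
open import Data.Integer using (ℤ; +_; +[1+_]; -[1+_]; 0ℤ; 1ℤ; _+_; _-_; _*_; _≤_; _<_; ∣_∣)
open import Data.Integer.DivMod using (_%ℕ_; n%ℕd<d)
import Data.Integer.Properties as ℤₚ
open import Data.List using (List; []; _∷_; foldr; filter; length)
open import Data.Nat as ℕ using (ℕ; zero; suc; NonZero)
open import Data.Nat.Divisibility as ℕ∣ using (_∣_)
open import Data.Product using (∃-syntax; _×_; _,_; proj₁; proj₂)
open import Data.Product.Properties using (≡-dec)
open import Data.Vec using (Vec; []; _∷_; lookup)
open import Function using (id; _∘_; Bijective)
open import Level using (0ℓ)
open import Relation.Binary using (Setoid; DecidableEquality)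
import Relation.Binary.Construct.On as On
open import Relation.Binary.PropositionalEquality using (_≡_; _≗_; refl; sym; trans)
open import Relation.Nullary using (yes; no; does)
open import Relation.Nullary.Decidable using (_×-dec_)
open import Algebra.Definitions.RawMonoid Data.Integer.+-0-rawMonoid using (sum)

------------------------------------------------------------------------
-- Affine permutations

record AffinePermutation (n : ℕ) : Set where
  field
    fun       : ℤ → ℤ
    bijective : Bijective _≡_ _≡_ fun
    periodic  : ∀ i → fun (i + + n) ≡ fun i + + n

open AffinePermutation public using (fun)

-- Membership in B_{k,n}. The element t of Fin n stands for i = t + 1, so the
-- sum is over 1 ≤ i ≤ n; the average being k is stated after multiplying by n.
record Bounded (k n : ℕ) (f : AffinePermutation n) : Set where
  field
    average : sum {n} (λ t → fun f (+ suc (toℕ t)) - + suc (toℕ t)) ≡ + n * + k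
    lower   : ∀ i → i ≤ fun f i
    upper   : ∀ i → fun f i ≤ i + + n

------------------------------------------------------------------------
-- Reduced words

-- sᵢ exchanges i + mn and i + 1 + mn for every integer m. For n = 1 this formula
-- gives the translation by 1, so only the empty word then represents the
-- identity, in agreement with the triviality of the group of type Ã₀.
s : ∀ {n} → Fin n → ℤ → ℤ
s {n} i j =
  if does (n ℕ∣.∣? ∣ j - + toℕ i ∣) then j + 1ℤ
  else if does (n ℕ∣.∣? ∣ j - + suc (toℕ i) ∣) then j - 1ℤ
  else j

evalWord : ∀ {n} → List (Fin n) → ℤ → ℤ
evalWord = foldr (λ i g → s i ∘ g) id

-- The affine permutation in the affine Weyl group attached to f: first shift
-- by -k, then apply f.
normalised : ∀ {n} → ℕ → AffinePermutation n → ℤ → ℤ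
normalised k f i = fun f (i - + k)

record ReducedWord {n : ℕ} (k : ℕ) (f : AffinePermutation n) : Set where
  field
    word    : List (Fin n)
    correct : evalWord word ≗ normalised k f
    minimal : (v : List (Fin n)) → evalWord v ≗ normalised k f → length word ℕ.≤ length v

------------------------------------------------------------------------
-- Lattice paths

data Step : Set where
  R U : Step

Point : Set
Point = ℤ × ℤ

origin : Point
origin = 0ℤ , 0ℤ

infixl 6 _⊕_ _⊖_
_⊕_ _⊖_ : Point → Point → Point
(x , y) ⊕ (x′ , y′) = x + x′ , y + y′
(x , y) ⊖ (x′ , y′) = x - x′ , y - y′

_≟ᴾ_ : DecidableEquality Point
_≟ᴾ_ = ≡-dec ℤₚ._≟_ ℤₚ._≟_

vec : Step → Point
vec R = 1ℤ , 0ℤ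
vec U = 0ℤ , 1ℤ

walk : ∀ {m} → Point → Vec Step m → Point
walk p []       = p
walk p (a ∷ as) = walk (p ⊕ vec a) as

translation : ℕ → ℕ → Point
translation k n = + n - + k , + k

record LatticePath (k n : ℕ) : Set where
  field
    steps : Vec Step n
    end   : walk origin steps ≡ translation k n

open LatticePath public using (steps)

-- A unit edge of the grid: horizontal for R and vertical for U, given by its
-- lower/left endpoint.
Edge : Set
Edge = Step × Point

-- Unit boxes are named by their lower left corner.
left right bottom top : Point → Edge
left   b = U , b
right  b = U , b ⊕ vec R
bottom b = R , b
top    b = R , b ⊕ vec U

data Tile : Set where
  crossing elbow : Tile

_≟ᵀ_ : DecidableEquality Tile
crossing ≟ᵀ crossing = yes refl
crossing ≟ᵀ elbow    = no λ ()
elbow    ≟ᵀ crossing = no λ ()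
elbow    ≟ᵀ elbow    = yes refl

open import Data.List.Membership.DecPropositional _≟ᴾ_ using (_∈?_)

module _ {k n : ℕ} .{{_ : NonZero n}} (P : LatticePath k n) where

  -- The vector of steps is indexed from 0, the steps of the path from 1.
  step : ℤ → Step
  step i = lookup (steps P) (fromℕ< (n%ℕd<d (i - 1ℤ) n))

  -- The point between steps i and i + 1 of the bi-infinite path.
  vertex : ℤ → Point
  vertex (+ zero)      = origin
  vertex +[1+ m ]      = vertex (+ m) ⊕ vec (step +[1+ m ])
  vertex -[1+ zero ]   = origin ⊖ vec (step 0ℤ)
  vertex -[1+ suc m ]  = vertex -[1+ m ] ⊖ vec (step -[1+ m ])

  start : ℤ → Point
  start i = vertex (i - 1ℤ)

  southern northern : ℤ → Edge
  southern i = step i , start i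
  northern i = step i , start i ⊕ (0ℤ , + k)

  -- In the column of an R-step of the path, the strip consists of the boxes
  -- above that step and below its translate by (0,k).
  record InStrip (b : Point) : Set where
    field
      index  : ℤ
      isR    : step index ≡ R
      column : proj₁ b ≡ proj₁ (start index)
      above  : proj₂ (start index) ≤ proj₂ b
      below  : proj₂ b < proj₂ (start index) + + k

  -- tile is only meaningful on boxes of the strip: no condition below looks at
  -- its other values, and _≈_ identifies fillings that agree on the strip.
  record Filling : Set where
    field
      tile     : Point → Tile
      periodic : ∀ b → InStrip b → tile (b ⊕ translation k n) ≡ tile b

  open Filling

  _≈_ : Filling → Filling → Set
  F ≈ G = ∀ b → InStrip b → tile F b ≡ tile G b

  fillingSetoid : Setoid 0ℓ 0ℓ
  fillingSetoid = record
    { Carrier       = Filling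
    ; _≈_           = _≈_
    ; isEquivalence = record
      { refl  = λ _ _ → refl
      ; sym   = λ e b h → sym (e b h)
      ; trans = λ e e′ b h → trans (e b h) (e′ b h)
      }
    }

  module _ (F : Filling) where

    data Traverse (b : Point) : Edge → Edge → Set where
      left-right  : tile F b ≡ crossing → Traverse b (left b) (right b)
      top-bottom  : tile F b ≡ crossing → Traverse b (top b)  (bottom b)
      left-bottom : tile F b ≡ elbow → Traverse b (left b) (bottom b)
      top-right   : tile F b ≡ elbow → Traverse b (top b)  (right b)

    -- A segment of a strand of F, from one edge to another.
    data Strand : Edge → Edge → Set where
      []  : ∀ {e} → Strand e e
      _∷_ : ∀ {b e e′ e″} → InStrip b × Traverse b e e′ → Strand e′ e″ → Strand e e″

    boxes : ∀ {e e′} → Strand e e′ → List Point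
    boxes []            = []
    boxes (_∷_ {b} _ p) = b ∷ boxes p

    crossings : ∀ {d d′ e e′} → Strand d d′ → Strand e e′ → ℕ
    crossings p q =
      length (filter (λ b → (tile F b ≟ᵀ crossing) ×-dec (b ∈? boxes q)) (boxes p))

    HasStrandPermutation : AffinePermutation n → Set
    HasStrandPermutation f = ∀ i → Strand (northern i) (southern (fun f i))

    -- The strands forming the elbow in b are the one entering b from the left
    -- and the one entering it from the top; p and q are their parts before b.
    Distinguished : Set
    Distinguished = ∀ b → InStrip b → tile F b ≡ elbow →
      ∀ i j (p : Strand (northern i) (left b)) (q : Strand (northern j) (top b)) →
      2 ∣ crossings p q

    -- Here p and q are the parts of the two strands after b.
    AntiDistinguished : Set
    AntiDistinguished = ∀ b → InStrip b → tile F b ≡ elbow →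
      ∀ i j (p : Strand (bottom b) (southern i)) (q : Strand (right b) (southern j)) →
      2 ∣ crossings p q

module _ {k n : ℕ} .{{_ : NonZero n}} (f : AffinePermutation n) (P : LatticePath k n) where

  Deo : Setoid 0ℓ 0ℓ
  Deo = On.setoid {B = ∃[ F ] HasStrandPermutation P F f × Distinguished P F}
                  (fillingSetoid P) proj₁

  AntiDeo : Setoid 0ℓ 0ℓ
  AntiDeo = On.setoid {B = ∃[ F ] HasStrandPermutation P F f × AntiDistinguished P F}
                      (fillingSetoid P) proj₁

{-# OPTIONS --safe #-}

-- Sweep the strip from north to south by periodic lattice paths, one box (with
-- its translates) at a time. A filling becomes a word of letters s_p or 1, and
-- its strand permutation the product of that word. Two strands have crossed an
-- even number of times iff they are still in their initial order, so the filling
-- is distinguished iff every letter 1 is chosen at a right ascent of the product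
-- of the letters before it, and anti-distinguished iff this holds at a left
-- ascent of the product of the letters after it.
--
-- Consider on formal sums of affine permutations the operators
-- R_q u = u s_q + [u < u s_q] u and L_p u = s_p u + [u < s_p u] u. Distinguished
-- words are counted by R_{q_m} ⋯ R_{q_1} 1 and anti-distinguished ones by
-- L_{q_1} ⋯ L_{q_m} 1. These agree because L_p 1 = R_p 1 and L_p R_q = R_q L_p.
-- The last identity is itself bijective: when s_p u = u s_q the two operators
-- coincide on the span of u and s_p u and the two choices are exchanged, and
-- otherwise neither choice affects the condition on the other.
module Submission where

open import Defs
open import Data.Bool using (Bool; true; false; not; _xor_; if_then_else_)
open import Data.Bool.Properties using (not-involutive; xor-assoc; xor-comm)
open import Data.Empty using (⊥; ⊥-elim)
open import Data.Fin using (toℕ) renaming (zero to fzero; suc to fsuc)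
import Data.Fin.Properties as Fin
open import Data.Integer using (∣_∣; ℤ; +_; +[1+_]; -[1+_]; 0ℤ; 1ℤ; _+_; _-_; -_; _*_; _<_; +≤+; +<+)
import Data.Integer as ℤ
open import Data.Integer.DivMod using (_%ℕ_; _/ℕ_; n%ℕd<d; a≡a%ℕn+[a/ℕn]*n)
import Data.Integer.Divisibility.Signed as Signed
import Data.Integer.Properties as ℤ
open import Data.Integer.Tactic.RingSolver using (solve-∀)
open import Data.List using (List; []; _∷_; [_]; _++_; filter; length)
open import Data.List.Membership.DecPropositional _≟ᴾ_ using (_∈?_)
open import Data.List.Membership.Propositional using (_∈_; _∉_)
open import Data.List.Membership.Propositional.Properties using (∈-++⁻; ∈-++⁺ˡ; ∈-++⁺ʳ)
open import Data.List.Properties using (filter-++; length-++; filter-none; filter-accept)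
import Data.List.Relation.Unary.All as All
open import Data.List.Relation.Unary.Any using (here; there)
open import Data.Nat using (ℕ; zero; suc; _≤_; NonZero)
import Data.Nat as ℕ
import Data.Nat.Divisibility as ℕ
open import Data.Nat.DivMod using (m<n⇒m%n≡m)
import Data.Nat.Properties as ℕ
open import Data.Product using (Σ-syntax; ∃-syntax; _×_; _,_; proj₁; proj₂)
open import Data.Sum using (_⊎_; inj₁; inj₂)
open import Data.Unit using (⊤; tt)
open import Data.Vec using (Vec; []; _∷_; lookup)
open import Data.Vec.Properties using (∷-injective)
open import Function using (_∘_; _⇔_; mk⇔; Equivalence)
open import Function.Bundles using (Bijection)
open import Relation.Binary using (Setoid; module Tri)
open import Relation.Binary.PropositionalEquality
  using (_≡_; _≢_; _≗_; refl; sym; trans; cong; cong₂; subst; subst₂; module ≡-Reasoning)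
open import Relation.Nullary using (¬_; Dec; yes; no; does; contradiction)
open import Relation.Nullary.Decidable using (map′; dec-true; dec-false; does-⇔; _×-dec_)

open Equivalence using () renaming (to to ⇒; from to ⇐)

-- The conditions on a filling quantify over all strand segments ending or starting at a box,
-- whereas the word knows one trajectory per position. Two facts link them. A strand that leaves a
-- cut never meets it again, so the segment between two edges is unique (`noReturn`,
-- `strand-unique`). On a fixed antidiagonal the vertices of the cuts only move right, so no box is
-- swept twice and the crossings add up letter by letter (`flipped-bound`, `parity`). `run` takes
-- positions to destinations, `state` takes positions to origins. From `ε` they are inverse to each
-- other, so an ascent of `run` is a left ascent of `state`; this lets both conditions be read on
-- one group element. The commutation identity is applied one letter at a time. Whether to exchange
-- depends only on the product of the letters before, without the travelling tile, so the reverse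
-- map can repeat every decision. Sweeping single boxes has to begin somewhere in the period. It
-- begins at an up-step, where successive vertical translates of the path share a vertex; without
-- up-steps the strip is empty. The period 1 is treated apart, since there p and p + 1 are
-- congruent.

shift-invariant : ∀ {a} {A : Set a} (φ : ℤ → A) → (∀ m → φ (m + 1ℤ) ≡ φ m) → ∀ m → φ m ≡ φ 0ℤ
shift-invariant φ inv (+ zero)       = refl
shift-invariant φ inv +[1+ m ]       =
  trans (cong φ (ℤ.+-comm 1ℤ (+ m))) (trans (inv (+ m)) (shift-invariant φ inv (+ m)))
shift-invariant φ inv -[1+ zero ]    = sym (inv -[1+ 0 ])
shift-invariant φ inv -[1+ suc m ]   =
  trans (sym (inv -[1+ suc m ])) (shift-invariant φ inv -[1+ m ])

<⇒+1≤ : ∀ {i j} → i < j → i + 1ℤ ℤ.≤ j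
<⇒+1≤ {i} i<j = subst (ℤ._≤ _) (ℤ.+-comm 1ℤ i) (ℤ.i<j⇒suc[i]≤j i<j)

+1≤⇒< : ∀ {i j} → i + 1ℤ ℤ.≤ j → i < j
+1≤⇒< {i} h = ℤ.suc[i]≤j⇒i<j (subst (ℤ._≤ _) (ℤ.+-comm i 1ℤ) h)

i<i+1 : ∀ i → i < i + 1ℤ
i<i+1 i = +1≤⇒< ℤ.≤-refl

i-1<i : ∀ i → i - 1ℤ < i
i-1<i i = +1≤⇒< (ℤ.≤-reflexive (ring i))
  where
  ring : ∀ i → i - 1ℤ + 1ℤ ≡ i
  ring = solve-∀

+-cancelʳ-≡ : ∀ k {i j} → i + k ≡ j + k → i ≡ j
+-cancelʳ-≡ k {i} {j} h = trans (ring i k) (trans (cong (_- k) h) (sym (ring j k)))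
  where
  ring : ∀ i k → i ≡ i + k - k
  ring = solve-∀

i-1+1 : ∀ i → i - 1ℤ + 1ℤ ≡ i
i-1+1 = solve-∀

i+1-1 : ∀ i → i + 1ℤ - 1ℤ ≡ i
i+1-1 = solve-∀

<⇒≤-1 : ∀ {i j} → i < j → i ℤ.≤ j - 1ℤ
<⇒≤-1 {i} {j} h = subst (ℤ._≤ j - 1ℤ) (i+1-1 i) (ℤ.+-monoˡ-≤ (- 1ℤ) (<⇒+1≤ h))

mono-from-step : (φ : ℤ → ℤ) → (∀ i → φ i ℤ.≤ φ (i + 1ℤ)) → ∀ {i j} → i ℤ.≤ j → φ i ℤ.≤ φ j
mono-from-step φ up {i} {j} i≤j = subst (λ t → φ i ℤ.≤ φ t) j-eq (climb (∣ j - i ∣))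
  where
  climb : ∀ m → φ i ℤ.≤ φ (i + + m)
  climb zero    = ℤ.≤-reflexive (cong φ (sym (ℤ.+-identityʳ i)))
  climb (suc m) = ℤ.≤-trans (climb m)
      (subst (λ t → φ (i + + m) ℤ.≤ φ t) (ring i (+ m)) (up (i + + m)))
    where
    ring : ∀ i m → i + m + 1ℤ ≡ i + (1ℤ + m)
    ring = solve-∀
  ring : ∀ i j → i + (j - i) ≡ j
  ring = solve-∀
  j-eq : i + + ∣ j - i ∣ ≡ j
  j-eq = trans (cong (λ t → i + t) (ℤ.0≤i⇒+∣i∣≡i (ℤ.i≤j⇒0≤j-i i≤j))) (ring i j)

-- Congruence modulo the period

module Congruence (n : ℕ) where

  infix 4 _≋_ _≋?_

  record _≋_ (i j : ℤ) : Set where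
    constructor by
    field
      periods  : ℤ
      equation : i ≡ j + periods * + n

  ≋-refl : ∀ {i} → i ≋ i
  ≋-refl {i} = by 0ℤ (ring i (+ n))
    where
    ring : ∀ i n → i ≡ i + 0ℤ * n
    ring = solve-∀

  ≋-reflexive : ∀ {i j} → i ≡ j → i ≋ j
  ≋-reflexive refl = ≋-refl

  ≋-sym : ∀ {i j} → i ≋ j → j ≋ i
  ≋-sym {j = j} (by m refl) = by (- m) (ring j m (+ n))
    where
    ring : ∀ j m n → j ≡ j + m * n + - m * n
    ring = solve-∀

  ≋-trans : ∀ {i j k} → i ≋ j → j ≋ k → i ≋ k
  ≋-trans {k = k} (by m refl) (by m′ refl) = by (m′ + m) (ring k m m′ (+ n))
    where
    ring : ∀ k m m′ n → k + m′ * n + m * n ≡ k + (m′ + m) * n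
    ring = solve-∀

  ≋-+ : ∀ {i j} k → i ≋ j → i + k ≋ j + k
  ≋-+ {j = j} k (by m refl) = by m (ring j k m (+ n))
    where
    ring : ∀ j k m n → j + m * n + k ≡ j + k + m * n
    ring = solve-∀

  ≋-period : ∀ i → i + + n ≋ i
  ≋-period i = by 1ℤ (cong (λ t → i + t) (sym (ℤ.*-identityˡ (+ n))))

  opaque
    _≋?_ : ∀ i j → Dec (i ≋ j)
    i ≋? j = map′ (λ (Signed.divides m e) → by m (trans (ring i j) (cong (λ t → j + t) e)))
                  (λ (by m e) → Signed.divides m (trans (cong (_- j) e) (ring′ j (m * + n))))
                  (+ n Signed.∣? i - j)
      where
      ring : ∀ i j → i ≡ j + (i - j)
      ring = solve-∀
      ring′ : ∀ j t → j + t - j ≡ t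
      ring′ = solve-∀

  -- Everything that relies on a period greater than 1 goes through this: the two classes moved by a
  -- simple reflection are distinct.
  +1-≋-absurd : 1 ℕ.< n → ∀ {i} → ¬ (i + 1ℤ ≋ i)
  +1-≋-absurd 1<n {i} (by m e) =
    ℕ.<⇒≢ 1<n (sym (ℕ.∣1⇒≡1 (Signed.∣⇒∣ᵤ (Signed.divides m one))))
    where
    ring : ∀ i → i + 1ℤ - i ≡ 1ℤ
    ring = solve-∀
    ring′ : ∀ i t → i + t - i ≡ t
    ring′ = solve-∀
    one : 1ℤ ≡ m * + n
    one = trans (sym (ring i)) (trans (cong (_- i) e) (ring′ i _))

-- Affine permutations and words

module Words (n : ℕ) (1<n : 1 ℕ.< n) where

  open Congruence n

  record Affine : Set where
    field
      to from : ℤ → ℤ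
      to-from : ∀ i → to (from i) ≡ i
      from-to : ∀ i → from (to i) ≡ i
      shift   : ∀ i → to (i + + n) ≡ to i + + n

    -- The difference `φ m` is unchanged by m ↦ m + 1, so it equals its value at 0, for negative m
    -- as well.
    shift-* : ∀ i m → to (i + m * + n) ≡ to i + m * + n
    shift-* i m = trans (ring (to (i + m * + n)) (m * + n))
      (trans (cong (_+ m * + n) (shift-invariant φ step-φ m))
             (cong (_+ m * + n) (trans (ring₀ (to (i + 0ℤ * + n)) (+ n))
                 (cong to (ring₁ i (+ n))))))
      where
      φ : ℤ → ℤ
      φ m = to (i + m * + n) - m * + n
      ring : ∀ a b → a ≡ a - b + b
      ring = solve-∀
      ring₀ : ∀ a n → a - 0ℤ * n ≡ a
      ring₀ = solve-∀
      ring₁ : ∀ i n → i + 0ℤ * n ≡ i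
      ring₁ = solve-∀
      ring₂ : ∀ i m n → i + (m + 1ℤ) * n ≡ i + m * n + n
      ring₂ = solve-∀
      ring₃ : ∀ a m n → a + n - (m + 1ℤ) * n ≡ a - m * n
      ring₃ = solve-∀
      step-φ : ∀ m → φ (m + 1ℤ) ≡ φ m
      step-φ m = trans (cong (_- (m + 1ℤ) * + n)
        (trans (cong to (ring₂ i m (+ n))) (shift (i + m * + n))))
            (ring₃ (to (i + m * + n)) m (+ n))

    injective : ∀ {i j} → to i ≡ to j → i ≡ j
    injective {i} {j} h = trans (sym (from-to i)) (trans (cong from h) (from-to j))

    to-≋ : ∀ {i j} → i ≋ j → to i ≋ to j
    to-≋ {j = j} (by m refl) = by m (shift-* j m)

  open Affine

  infixr 9 _∙_

  ε : Affine
  ε = record { to = λ i → i ; from = λ i → i ; to-from = λ _ → refl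
             ; from-to = λ _ → refl ; shift = λ _ → refl }

  _∙_ : Affine → Affine → Affine
  g ∙ h = record
    { to      = to g ∘ to h
    ; from    = from h ∘ from g
    ; to-from = λ i → trans (cong (to g) (to-from h (from g i))) (to-from g i)
    ; from-to = λ i → trans (cong (from h) (from-to g (to h i))) (from-to h i)
    ; shift   = λ i → trans (cong (to g) (shift h i)) (shift g (to h i))
    }

  _⁻¹ : Affine → Affine
  g ⁻¹ = record
    { to = from g ; from = to g ; to-from = from-to g ; from-to = to-from g
    ; shift = λ i → trans (cong (λ t → from g (t + + n)) (sym (to-from g i)))
                   (trans (cong (from g) (sym (shift g (from g i)))) (from-to g _)) }

  from-≋ : ∀ g {i j} → to g i ≋ to g j → i ≋ j
  from-≋ g {i} {j} h = subst₂ _≋_ (from-to g i) (from-to g j) (to-≋ (g ⁻¹) h)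

  from-cong : ∀ g h → to g ≗ to h → from g ≗ from h
  from-cong g h e i =
    trans (sym (from-to h (from g i))) (cong (from h) (trans (sym (e (from g i))) (to-from g i)))

  swap : ℤ → ℤ → ℤ
  swap p i with i ≋? p | i ≋? p + 1ℤ
  ... | yes _ | _     = i + 1ℤ
  ... | no _  | yes _ = i - 1ℤ
  ... | no _  | no _  = i

  data Swapped (p i : ℤ) : ℤ → Set where
    at-p   : i ≋ p → Swapped p i (i + 1ℤ)
    at-p+1 : i ≋ p + 1ℤ → Swapped p i (i - 1ℤ)
    off    : ¬ i ≋ p → ¬ i ≋ p + 1ℤ → Swapped p i i

  swapped : ∀ p i → Swapped p i (swap p i)
  swapped p i with i ≋? p | i ≋? p + 1ℤ
  ... | yes a | _     = at-p a
  ... | no a  | yes b = at-p+1 b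
  ... | no a  | no b  = off a b

  exclusive : ∀ {p i} → i ≋ p → ¬ i ≋ p + 1ℤ
  exclusive a b = +1-≋-absurd 1<n (≋-trans (≋-sym b) a)

  swap-at : ∀ {p i} → i ≋ p → swap p i ≡ i + 1ℤ
  swap-at {p} {i} a with swap p i | swapped p i
  ... | _ | at-p _   = refl
  ... | _ | at-p+1 b = contradiction b (exclusive a)
  ... | _ | off ¬a _ = contradiction a ¬a

  swap-at-+1 : ∀ {p i} → i ≋ p + 1ℤ → swap p i ≡ i - 1ℤ
  swap-at-+1 {p} {i} b with swap p i | swapped p i
  ... | _ | at-p a   = contradiction b (exclusive a)
  ... | _ | at-p+1 _ = refl
  ... | _ | off _ ¬b = contradiction b ¬b

  swap-off : ∀ {p i} → ¬ i ≋ p → ¬ i ≋ p + 1ℤ → swap p i ≡ i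
  swap-off {p} {i} ¬a ¬b with swap p i | swapped p i
  ... | _ | at-p a   = contradiction a ¬a
  ... | _ | at-p+1 b = contradiction b ¬b
  ... | _ | off _ _  = refl

  ≋-pred : ∀ {i p} → i ≋ p + 1ℤ → i - 1ℤ ≋ p
  ≋-pred {i} {p} b = subst (i - 1ℤ ≋_) (i+1-1 p) (≋-+ (- 1ℤ) b)

  swap-involutive : ∀ p i → swap p (swap p i) ≡ i
  swap-involutive p i with swap p i | swapped p i
  ... | _ | at-p a     = trans (swap-at-+1 (≋-+ 1ℤ a)) (i+1-1 i)
  ... | _ | at-p+1 b   = trans (swap-at (≋-pred b)) (i-1+1 i)
  ... | _ | off ¬a ¬b  = swap-off ¬a ¬b

  swap-shift : ∀ p i → swap p (i + + n) ≡ swap p i + + n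
  swap-shift p i with swap p i | swapped p i
  ... | _ | at-p a    = trans (swap-at (≋-trans (≋-period i) a)) (ring i (+ n))
    where
    ring : ∀ i n → i + n + 1ℤ ≡ i + 1ℤ + n
    ring = solve-∀
  ... | _ | at-p+1 b  = trans (swap-at-+1 (≋-trans (≋-period i) b)) (ring i (+ n))
    where
    ring : ∀ i n → i + n - 1ℤ ≡ i - 1ℤ + n
    ring = solve-∀
  ... | _ | off ¬a ¬b = swap-off (¬a ∘ ≋-trans (≋-sym (≋-period i)))
                                 (¬b ∘ ≋-trans (≋-sym (≋-period i)))

  -- Values move by at most 1, so an order can be lost only between neighbours. If i moves up and j
  -- down, then j - i ≥ 2, and j - i = 2 would put i + 1 in the class of i.
  swap-mono : ∀ p {i j} → i < j → swap p i ≢ j → swap p i < swap p j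
  swap-mono p {i} {j} i<j ≢j with swap p i | swapped p i | swap p j | swapped p j
  ... | _ | at-p _   | _ | at-p _    = ℤ.+-monoˡ-< 1ℤ i<j
  ... | _ | at-p a   | _ | at-p+1 b  = ℤ.≤∧≢⇒<
          (subst (ℤ._≤ j - 1ℤ) (i+1-1 (i + 1ℤ))
            (ℤ.+-monoˡ-≤ (- 1ℤ) (<⇒+1≤ (ℤ.≤∧≢⇒< (<⇒+1≤ i<j) ≢j))))
          (λ e → +1-≋-absurd 1<n (≋-trans (subst (_≋ p) (sym e) (≋-pred b)) (≋-sym a)))
  ... | _ | at-p _   | _ | off _ _   = ℤ.≤∧≢⇒< (<⇒+1≤ i<j) ≢j
  ... | _ | at-p+1 _ | _ | at-p _    = ℤ.<-trans (i-1<i i) (ℤ.<-trans i<j (i<i+1 j))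
  ... | _ | at-p+1 _ | _ | at-p+1 _  = ℤ.+-monoˡ-< (- 1ℤ) i<j
  ... | _ | at-p+1 _ | _ | off _ _   = ℤ.<-trans (i-1<i i) i<j
  ... | _ | off _ _  | _ | at-p _    = ℤ.<-trans i<j (i<i+1 j)
  ... | _ | off ¬a _ | _ | at-p+1 b  = ℤ.≤∧≢⇒<
          (subst (ℤ._≤ j - 1ℤ) (i+1-1 i) (ℤ.+-monoˡ-≤ (- 1ℤ) (<⇒+1≤ i<j)))
          (λ e → ¬a (subst (_≋ p) (sym e) (≋-pred b)))
  ... | _ | off _ _  | _ | off _ _   = i<j

  transposition : ℤ → Affine
  transposition p = record
    { to = swap p ; from = swap p ; to-from = swap-involutive p ; from-to = swap-involutive p
    ; shift = swap-shift p }

  act : Tile → ℤ → Affine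
  act crossing p = transposition p
  act elbow    p = ε

  act-involutive : ∀ τ p i → to (act τ p) (to (act τ p) i) ≡ i
  act-involutive crossing = swap-involutive
  act-involutive elbow    = λ _ _ → refl

  run : (w : List ℤ) → Vec Tile (length w) → Affine
  run []      []       = ε
  run (p ∷ w) (τ ∷ τs) = run w τs ∙ act τ p

  state : Affine → (w : List ℤ) → Vec Tile (length w) → Affine
  state g []      []       = g
  state g (p ∷ w) (τ ∷ τs) = state (g ∙ act τ p) w τs

  -- The two products have opposite orders and every letter is an involution, so they cancel letter
  -- by letter.
  state-run : ∀ g w τs i → to (state g w τs) (to (run w τs) i) ≡ to g i
  state-run g []      []       i = refl
  state-run g (p ∷ w) (τ ∷ τs) i = trans (state-run (g ∙ act τ p) w τs (to (act τ p) i))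
                                         (cong (to g) (act-involutive τ p i))

  state-cong : ∀ g h w τs → to g ≗ to h → to (state g w τs) ≗ to (state h w τs)
  state-cong g h []      []       e = e
  state-cong g h (p ∷ w) (τ ∷ τs) e = state-cong (g ∙ act τ p) (h ∙ act τ p) w τs (e ∘ to (act τ p))

  -- An implication, because a crossing may be chosen freely and only an elbow is constrained.
  Ascent : (ℤ → ℤ) → ℤ → Tile → Set
  Ascent u p τ = τ ≡ elbow → u p < u (p + 1ℤ)

  DistinguishedFrom : Affine → (w : List ℤ) → Vec Tile (length w) → Set
  DistinguishedFrom g []      []       = ⊤
  DistinguishedFrom g (p ∷ w) (τ ∷ τs) = Ascent (to g) p τ × DistinguishedFrom (g ∙ act τ p) w τs

  AntiDistinguishedWord : (w : List ℤ) → Vec Tile (length w) → Set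
  AntiDistinguishedWord []      []       = ⊤
  AntiDistinguishedWord (p ∷ w) (τ ∷ τs) =
    Ascent (to (run w τs)) p τ × AntiDistinguishedWord w τs

  Ascent-cong : ∀ {u v} p {τ} → u ≗ v → Ascent u p τ → Ascent v p τ
  Ascent-cong p e h eq = subst₂ _<_ (e p) (e (p + 1ℤ)) (h eq)

  DistinguishedFrom-cong : ∀ g h w τs → to g ≗ to h →
    DistinguishedFrom g w τs → DistinguishedFrom h w τs
  DistinguishedFrom-cong g h []      []       e d       = d
  DistinguishedFrom-cong g h (p ∷ w) (τ ∷ τs) e (a , d) =
    Ascent-cong p e a , DistinguishedFrom-cong (g ∙ act τ p) (h ∙ act τ p) w τs (e ∘ to (act τ p)) d

  -- Simple reflections acting on the left and on the right

  Match : Affine → ℤ → ℤ → Set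
  Match g p q = swap p (to g q) ≡ to g (q + 1ℤ)

  match? : ∀ g p q → Dec (Match g p q)
  match? g p q = swap p (to g q) ℤ.≟ to g (q + 1ℤ)

  -- The cases u < u s_q and u > u s_q of the equation s_p u = u s_q.
  data MatchView (g : Affine) (p q : ℤ) : Set where
    aligned  : to g q ≋ p → to g (q + 1ℤ) ≡ to g q + 1ℤ → MatchView g p q
    reversed : to g q ≋ p + 1ℤ → to g (q + 1ℤ) ≡ to g q - 1ℤ → MatchView g p q

  matchView : ∀ g p q → Match g p q → MatchView g p q
  matchView g p q m with swap p (to g q) | swapped p (to g q)
  ... | _ | at-p a   = aligned a (sym m)
  ... | _ | at-p+1 b = reversed b (sym m)
  ... | _ | off _ _  = contradiction (injective g m) (ℤ.<⇒≢ (i<i+1 q))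

  -- Agreement at q spreads to its class by periodicity and to the class of q + 1 by involutivity;
  -- elsewhere `g` avoids the classes of p and p + 1, so nothing moves. Thus `Match g p q` amounts
  -- to s_p g = g s_q.
  match-comm : ∀ g p q → Match g p q → ∀ i → swap p (to g i) ≡ to g (swap q i)
  match-comm g p q m i with swap q i | swapped q i
  ... | _ | at-p (by k refl) = begin
    swap p (to g (q + k * + n))       ≡⟨ cong (swap p) (shift-* g q k) ⟩
    swap p (to g q + k * + n)         ≡⟨ shift-* (transposition p) (to g q) k ⟩
    swap p (to g q) + k * + n         ≡⟨ cong (_+ k * + n) m ⟩
    to g (q + 1ℤ) + k * + n           ≡⟨ shift-* g (q + 1ℤ) k ⟨
    to g (q + 1ℤ + k * + n)           ≡⟨ cong (to g) (ring q (k * + n)) ⟩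
    to g (q + k * + n + 1ℤ)           ∎
    where
    open ≡-Reasoning
    ring : ∀ q t → q + 1ℤ + t ≡ q + t + 1ℤ
    ring = solve-∀
  ... | _ | at-p+1 (by k refl) = begin
    swap p (to g (q + 1ℤ + k * + n))  ≡⟨ cong (swap p) (shift-* g (q + 1ℤ) k) ⟩
    swap p (to g (q + 1ℤ) + k * + n)  ≡⟨ shift-* (transposition p) (to g (q + 1ℤ)) k ⟩
    swap p (to g (q + 1ℤ)) + k * + n  ≡⟨ cong (λ t → swap p t + k * + n) m ⟨
    swap p (swap p (to g q)) + k * + n ≡⟨ cong (_+ k * + n) (swap-involutive p (to g q)) ⟩
    to g q + k * + n                  ≡⟨ shift-* g q k ⟨
    to g (q + k * + n)                ≡⟨ cong (to g) (ring q (k * + n)) ⟩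
    to g (q + 1ℤ + k * + n - 1ℤ)      ∎
    where
    open ≡-Reasoning
    ring : ∀ q t → q + t ≡ q + 1ℤ + t - 1ℤ
    ring = solve-∀
  ... | _ | off ¬a ¬b with matchView g p q m
  ...   | aligned c e = swap-off (λ d → ¬a (from-≋ g (≋-trans d (≋-sym c))))
            (λ d → ¬b (from-≋ g (≋-trans d (≋-trans (≋-sym (≋-+ 1ℤ c)) (≋-reflexive (sym e))))))
  ...   | reversed c e = swap-off
            (λ d → ¬b (from-≋ g (≋-trans d (≋-trans (≋-sym (≋-pred c)) (≋-reflexive (sym e))))))
            (λ d → ¬a (from-≋ g (≋-trans d (≋-sym c))))

  -- The equations s_p g = g s_q and s_q g⁻¹ = g⁻¹ s_p are the same. Used contrapositively: a failed
  -- match also fails for the inverse, with p and q exchanged.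
  match-unique : ∀ g p q → swap q (from g p) ≡ from g (p + 1ℤ) → Match g p q
  match-unique g p q m = sym (trans (cong (to g) (trans (sym (swap-at ≋-refl))
      (trans (cong (swap q) (sym (from-to g q))) (match-comm (g ⁻¹) q p m (to g q)))))
    (to-from g (swap p (to g q))))

  -- Up to a common multiple of n, `g` carries the pair q, q + 1 onto p, p + 1. Its inverse carries
  -- the pair back, and the order is kept by both or reversed by both.
  match-ascent : ∀ g p q {τ} → Match g p q → Ascent (to g) q τ ⇔ Ascent (from g) p τ
  match-ascent g p q m with matchView g p q m
  ... | aligned (by k e) e′ = mk⇔
    (λ _ _ → subst₂ _<_ (sym g⁻¹p) (sym g⁻¹p+1) (ℤ.+-monoˡ-< (- k * + n) (i<i+1 q)))
    (λ _ _ → subst (to g q <_) (sym e′) (i<i+1 (to g q)))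
    where
    open ≡-Reasoning
    ring : ∀ p k n → p ≡ p + k * n + - k * n
    ring = solve-∀
    ring′ : ∀ p k n → p + 1ℤ ≡ p + k * n + 1ℤ + - k * n
    ring′ = solve-∀
    g⁻¹p : from g p ≡ q + - k * + n
    g⁻¹p = begin
      from g p                      ≡⟨ cong (from g)
          (trans (ring p k (+ n)) (cong (_+ - k * + n) (sym e))) ⟩
      from g (to g q + - k * + n)   ≡⟨ shift-* (g ⁻¹) (to g q) (- k) ⟩
      from g (to g q) + - k * + n   ≡⟨ cong (_+ - k * + n) (from-to g q) ⟩
      q + - k * + n ∎
    g⁻¹p+1 : from g (p + 1ℤ) ≡ q + 1ℤ + - k * + n
    g⁻¹p+1 = begin
      from g (p + 1ℤ)                    ≡⟨ cong (from g)
          (trans (ring′ p k (+ n)) (cong (λ t → t + 1ℤ + - k * + n) (sym e))) ⟩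
      from g (to g q + 1ℤ + - k * + n)   ≡⟨ cong (λ t → from g (t + - k * + n)) e′ ⟨
      from g (to g (q + 1ℤ) + - k * + n) ≡⟨ shift-* (g ⁻¹) (to g (q + 1ℤ)) (- k) ⟩
      from g (to g (q + 1ℤ)) + - k * + n ≡⟨ cong (_+ - k * + n) (from-to g (q + 1ℤ)) ⟩
      q + 1ℤ + - k * + n ∎
  ... | reversed (by k e) e′ = mk⇔
    (λ h eq → contradiction (h eq) (ℤ.<-asym (subst (_< to g q) (sym e′) (i-1<i (to g q)))))
    (λ h eq → contradiction (subst₂ _<_ g⁻¹p g⁻¹p+1 (h eq))
        (ℤ.<-asym (ℤ.+-monoˡ-< (- k * + n) (i<i+1 q))))
    where
    open ≡-Reasoning
    ring : ∀ p k n → p ≡ p + 1ℤ + k * n - 1ℤ + - k * n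
    ring = solve-∀
    ring′ : ∀ p k n → p + 1ℤ ≡ p + 1ℤ + k * n + - k * n
    ring′ = solve-∀
    g⁻¹p : from g p ≡ q + 1ℤ + - k * + n
    g⁻¹p = begin
      from g p                           ≡⟨ cong (from g)
          (trans (ring p k (+ n)) (cong (λ t → t - 1ℤ + - k * + n) (sym e))) ⟩
      from g (to g q - 1ℤ + - k * + n)   ≡⟨ cong (λ t → from g (t + - k * + n)) e′ ⟨
      from g (to g (q + 1ℤ) + - k * + n) ≡⟨ shift-* (g ⁻¹) (to g (q + 1ℤ)) (- k) ⟩
      from g (to g (q + 1ℤ)) + - k * + n ≡⟨ cong (_+ - k * + n) (from-to g (q + 1ℤ)) ⟩
      q + 1ℤ + - k * + n ∎
    g⁻¹p+1 : from g (p + 1ℤ) ≡ q + - k * + n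
    g⁻¹p+1 = begin
      from g (p + 1ℤ)               ≡⟨ cong (from g)
          (trans (ring′ p k (+ n)) (cong (_+ - k * + n) (sym e))) ⟩
      from g (to g q + - k * + n)   ≡⟨ shift-* (g ⁻¹) (to g q) (- k) ⟩
      from g (to g q) + - k * + n   ≡⟨ cong (_+ - k * + n) (from-to g q) ⟩
      q + - k * + n ∎

  swap-reflects-< : ∀ p {i j} → i ≢ j → swap p i ≢ j → swap p i < swap p j → i < j
  swap-reflects-< p {i} {j} i≢j ≢j h with ℤ.<-cmp i j
  ... | Tri.tri< i<j _ _ = i<j
  ... | Tri.tri≈ _ i≡j _ = contradiction i≡j i≢j
  ... | Tri.tri> _ _ j<i = contradiction h (ℤ.<-asym (swap-mono p j<i
          (λ e → ≢j (trans (cong (swap p) (sym e)) (swap-involutive p j)))))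

  -- By `swap-mono`, s_p can reverse the two values only by exchanging them. A bare injective
  -- function `u` is taken so that the lemma serves both `g` and its inverse.
  act-ascent : ∀ σ p (u : ℤ → ℤ) q {τ} → (∀ {i j} → u i ≡ u j → i ≡ j) → swap p (u q) ≢ u (q + 1ℤ) →
    Ascent u q τ ⇔ Ascent (to (act σ p) ∘ u) q τ
  act-ascent elbow    p u q inj ¬m = mk⇔ (λ h → h) (λ h → h)
  act-ascent crossing p u q inj ¬m = mk⇔
    (λ h e → swap-mono p (h e) ¬m)
    (λ h e → swap-reflects-< p (λ e′ → ℤ.<⇒≢ (i<i+1 q) (inj e′)) ¬m (h e))

  match-comm-act : ∀ g p q → Match g p q → ∀ τ i → to (act τ p) (to g i) ≡ to g (to (act τ q) i)
  match-comm-act g p q m crossing i = match-comm g p q m i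
  match-comm-act g p q m elbow    i = refl

  match-act : ∀ g p q σ → Match g p q → Match (g ∙ act σ q) p q
  match-act g p q elbow    m = m
  match-act g p q crossing m = trans (match-comm g p q m (swap q q))
    (cong (to g) (trans (swap-involutive q q) (trans (sym (i+1-1 q)) (sym (swap-at-+1 ≋-refl)))))

  -- A matched letter passes through `g`, and two letters at the same p commute; both sides thus
  -- reduce to the two letters at p times `g`.
  match-exchange : ∀ g p q → Match g p q → ∀ τ σ →
    to ((act τ p ∙ g) ∙ act σ q) ≗ to (act σ p ∙ (g ∙ act τ q))
  match-exchange g p q m τ σ i = trans (cong (to (act τ p)) (sym (match-comm-act g p q m σ i)))
    (trans (act-comm τ σ (to g i)) (cong (to (act σ p)) (match-comm-act g p q m τ i)))
    where
    act-comm : ∀ τ σ j → to (act τ p) (to (act σ p) j) ≡ to (act σ p) (to (act τ p) j)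
    act-comm crossing crossing j = refl
    act-comm crossing elbow    j = refl
    act-comm elbow    σ        j = refl

  -- A tile for p that acts on the left, after the word w, is moved in front of w.
  -- Where the left and the right action agree, it is exchanged with the tile of w.
  pull : Affine → ℤ → (w : List ℤ) → Vec Tile (length w) → Tile → Tile × Vec Tile (length w)
  pull g p []      []       σ = σ , []
  pull g p (q ∷ w) (τ ∷ τs) σ with match? g p q | pull (g ∙ act τ q) p w τs σ
  ... | yes _ | σ₁ , τs₁ = τ , σ₁ ∷ τs₁
  ... | no  _ | σ₁ , τs₁ = σ₁ , τ ∷ τs₁

  -- The inverse of `pull`. Both test the match on the same `g`, the product of the earlier letters
  -- on the `pull` side, and therefore take the same branch.
  push : Affine → ℤ → (w : List ℤ) → Tile → Vec Tile (length w) → Vec Tile (length w) × Tile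
  push g p []      σ []       = [] , σ
  push g p (q ∷ w) σ (τ ∷ τs) with match? g p q
  -- The travelling tile `σ` is the original tile of q here, so it is the one that continues `g`,
  -- and `τ` travels on.
  ... | yes _ = let τs₁ , σ₁ = push (g ∙ act σ q) p w τ τs in σ ∷ τs₁ , σ₁
  ... | no  _ = let τs₁ , σ₁ = push (g ∙ act τ q) p w σ τs in τ ∷ τs₁ , σ₁

  push-pull : ∀ g p w τs σ → let σ₁ , τs₁ = pull g p w τs σ in push g p w σ₁ τs₁ ≡ (τs , σ)
  push-pull g p []      []       σ = refl
  push-pull g p (q ∷ w) (τ ∷ τs) σ
    with match? g p q in eq | pull (g ∙ act τ q) p w τs σ | push-pull (g ∙ act τ q) p w τs σ
  ... | yes _ | σ₁ , τs₁ | ih rewrite eq | ih = refl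
  ... | no  _ | σ₁ , τs₁ | ih rewrite eq | ih = refl

  pull-push : ∀ g p w σ τs → let τs₁ , σ₁ = push g p w σ τs in pull g p w τs₁ σ₁ ≡ (σ , τs)
  pull-push g p []      σ []       = refl
  pull-push g p (q ∷ w) σ (τ ∷ τs) with match? g p q in eq
  ... | yes _ rewrite eq | pull-push (g ∙ act σ q) p w τ τs = refl
  ... | no  _ rewrite eq | pull-push (g ∙ act τ q) p w σ τs = refl

  pull-state : ∀ g p w τs σ → let σ₁ , τs₁ = pull g p w τs σ in
    to (state (act σ₁ p ∙ g) w τs₁) ≗ to (act σ p ∙ state g w τs)
  pull-state g p []      []       σ i = refl
  pull-state g p (q ∷ w) (τ ∷ τs) σ i
    with match? g p q | pull (g ∙ act τ q) p w τs σ | pull-state (g ∙ act τ q) p w τs σ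
  ... | yes m | σ₁ , τs₁ | ih = trans
      (state-cong ((act τ p ∙ g) ∙ act σ₁ q) (act σ₁ p ∙ (g ∙ act τ q)) w τs₁
          (match-exchange g p q m τ σ₁) i) (ih i)
  ... | no ¬m | σ₁ , τs₁ | ih = trans
      (state-cong ((act σ₁ p ∙ g) ∙ act τ q) (act σ₁ p ∙ (g ∙ act τ q)) w τs₁
          (λ _ → refl) i) (ih i)

  from-act : ∀ τ p i → to (act τ p) i ≡ from (act τ p) i
  from-act crossing p i = refl
  from-act elbow    p i = refl

  -- The identity L_p R_q = R_q L_p iterated along `w`: the left ascent demanded of `σ` after the
  -- word becomes a left ascent demanded of `σ₁` before it.
  pull-distinguished : ∀ g p w τs σ → let σ₁ , τs₁ = pull g p w τs σ in
    (DistinguishedFrom g w τs × Ascent (from (state g w τs)) p σ) ⇔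
    (DistinguishedFrom (act σ₁ p ∙ g) w τs₁ × Ascent (from g) p σ₁)
  pull-distinguished g p []      []       σ = mk⇔ (λ h → h) (λ h → h)
  pull-distinguished g p (q ∷ w) (τ ∷ τs) σ
    with match? g p q | pull (g ∙ act τ q) p w τs σ | pull-distinguished (g ∙ act τ q) p w τs σ
  -- The tiles trade places, so `match-ascent` turns the right ascent for `τ` into a left one, and
  -- conversely for `σ₁`.
  ... | yes m | σ₁ , τs₁ | ih = mk⇔
    (λ ((a , d) , b) → let d₁ , b₁ = ⇒ ih (d , b) in
      ( Ascent-cong q (λ i → sym (comm i)) (⇐ (match-ascent (g ∙ act τ q) p q m′) b₁)
      , DistinguishedFrom-cong _ _ w τs₁ (λ i → sym (exchange i)) d₁)
      , ⇒ (match-ascent g p q m) a)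
    (λ ((a , d) , b) → let d₁ , b₁ = ⇐ ih ( DistinguishedFrom-cong _ _ w τs₁ exchange d
                                            , ⇒ (match-ascent (g ∙ act τ q) p q m′)
                                                (Ascent-cong q comm a)) in
      (⇐ (match-ascent g p q m) b , d₁) , b₁)
    where
    m′ = match-act g p q τ m
    comm = match-comm-act g p q m τ
    exchange = match-exchange g p q m τ σ₁
  -- Both tiles stay: `atq` carries the right ascent past the letter at p, and `atp` carries the
  -- left ascent past the letter at q, seen on the inverse.
  ... | no ¬m | σ₁ , τs₁ | ih = mk⇔
    (λ ((a , d) , b) → let d₁ , b₁ = ⇒ ih (d , b) in
      (⇒ atq a , DistinguishedFrom-cong _ _ w τs₁ (λ _ → refl) d₁) , ⇐ atp
          (Ascent-cong p (λ i → sym (from-act τ q (from g i))) b₁))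
    (λ ((a , d) , b) → let d₁ , b₁ = ⇐ ih ( DistinguishedFrom-cong _ _ w τs₁ (λ _ → refl) d
                                            , Ascent-cong p (λ i → from-act τ q (from g i))
                                                (⇒ atp b)) in
      (⇐ atq a , d₁) , b₁)
    where
    atq : Ascent (to g) q τ ⇔ Ascent (to (act σ₁ p ∙ g)) q τ
    atq = act-ascent σ₁ p (to g) q (injective g) ¬m
    atp : Ascent (from g) p σ₁ ⇔ Ascent (to (act τ q) ∘ from g) p σ₁
    atp = act-ascent τ q (from g) p (injective (g ⁻¹)) (¬m ∘ match-unique g p q)

  -- The bijection on words

  distinguish : (w : List ℤ) → Vec Tile (length w) → Vec Tile (length w)
  distinguish []      []       = []
  distinguish (p ∷ w) (σ ∷ τs) = let σ₁ , τs₁ = pull ε p w (distinguish w τs) σ in σ₁ ∷ τs₁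

  undistinguish : (w : List ℤ) → Vec Tile (length w) → Vec Tile (length w)
  undistinguish []      []       = []
  undistinguish (p ∷ w) (σ ∷ τs) = let τs₁ , σ₁ = push ε p w σ τs in σ₁ ∷ undistinguish w τs₁

  distinguish-undistinguish : ∀ w τs → distinguish w (undistinguish w τs) ≡ τs
  distinguish-undistinguish []      []       = refl
  distinguish-undistinguish (p ∷ w) (σ ∷ τs)
    rewrite distinguish-undistinguish w (proj₁ (push ε p w σ τs)) | pull-push ε p w σ τs = refl

  undistinguish-distinguish : ∀ w τs → undistinguish w (distinguish w τs) ≡ τs
  undistinguish-distinguish []      []       = refl
  undistinguish-distinguish (p ∷ w) (σ ∷ τs)
    rewrite push-pull ε p w (distinguish w τs) σ | undistinguish-distinguish w τs = refl

  -- Both sides are compared after `X`, the inverse of the left-hand side. By `pull-state`, `X` is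
  -- the first letter followed on its right by the inverse of the product of the tail.
  run-distinguish : ∀ w τs → to (run w (distinguish w τs)) ≗ to (run w τs)
  run-distinguish []      []       i = refl
  run-distinguish (p ∷ w) (σ ∷ τs) i = injective X
    (trans (state-run ε (p ∷ w) (σ₁ ∷ τs₁) i) (sym (begin
      to X (to (run w τs) j)                         ≡⟨ cong (to X) (run-distinguish w τs j) ⟨
      to X (to (run w u) j)                          ≡⟨ state-cong (ε ∙ act σ₁ p) (act σ₁ p ∙ ε) w
          τs₁ (λ _ → refl) (to (run w u) j) ⟩
      to (state (act σ₁ p ∙ ε) w τs₁) (to (run w u) j) ≡⟨ pull-state ε p w u σ (to (run w u) j) ⟩
      to (act σ p) (to (state ε w u) (to (run w u) j)) ≡⟨ cong (to (act σ p)) (state-run ε w u j) ⟩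
      to (act σ p) j                                 ≡⟨ act-involutive σ p i ⟩
      i                                              ∎)))
    where
    open ≡-Reasoning
    j = to (act σ p) i
    u = distinguish w τs
    σ₁ = proj₁ (pull ε p w u σ)
    τs₁ = proj₂ (pull ε p w u σ)
    X = state ε (p ∷ w) (σ₁ ∷ τs₁)

  -- The product of the tail is the inverse of its `state`, so the condition on the first letter is
  -- a left ascent of that state. Pulled to the front, it becomes a left ascent of `ε`, which is the
  -- same as a right ascent: L_p 1 = R_p 1.
  distinguish-correct : ∀ w τs → AntiDistinguishedWord w τs ⇔ DistinguishedFrom ε w
      (distinguish w τs)
  distinguish-correct []      []       = mk⇔ (λ h → h) (λ h → h)
  distinguish-correct (p ∷ w) (σ ∷ τs) = mk⇔
    (λ (a , d) → let d₁ , b = ⇒ pulled (⇒ ih d , Ascent-cong p run-from a)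
                 in b , DistinguishedFrom-cong _ _ w τs₁ (λ _ → refl) d₁)
    (λ (a , d) → let d₁ , b = ⇐ pulled (DistinguishedFrom-cong _ _ w τs₁ (λ _ → refl) d , a)
                 in Ascent-cong p (λ i → sym (run-from i)) b , ⇐ ih d₁)
    where
    u = distinguish w τs
    τs₁ = proj₂ (pull ε p w u σ)
    ih = distinguish-correct w τs
    pulled = pull-distinguished ε p w u σ
    run-from : to (run w τs) ≗ from (state ε w u)
    run-from i = trans (sym (run-distinguish w τs i))
      (injective (state ε w u) (trans (state-run ε w u i) (sym (to-from (state ε w u) i))))

-- Uniqueness of remainders

module Remainder (n : ℕ) .{{_ : NonZero n}} where

  open Congruence n

  private
    quotient-≮ : ∀ {r r′ q q′} → r ℕ.< n → + r + q * + n ≡ + r′ + q′ * + n → ¬ q < q′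
    quotient-≮ {r} {r′} {q} {q′} r<n e q<q′ = ℤ.<-irrefl e (begin-strict
      + r + q * + n    <⟨ ℤ.+-monoˡ-< (q * + n) (+<+ r<n) ⟩
      + n + q * + n    ≡⟨ ring q (+ n) ⟩
      (q + 1ℤ) * + n   ≤⟨ ℤ.*-monoʳ-≤-nonNeg (+ n) (<⇒+1≤ q<q′) ⟩
      q′ * + n         ≤⟨ ℤ.i≤j+i (q′ * + n) (+ r′) ⟩
      + r′ + q′ * + n  ∎)
      where
      open ℤ.≤-Reasoning
      ring : ∀ q n → n + q * n ≡ (q + 1ℤ) * n
      ring = solve-∀

  remainder-unique : ∀ {r r′ q q′} → r ℕ.< n → r′ ℕ.< n →
    + r + q * + n ≡ + r′ + q′ * + n → r ≡ r′
  remainder-unique {q = q} {q′} r<n r′<n e with ℤ.<-cmp q q′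
  ... | Tri.tri< q<q′ _ _ = contradiction q<q′ (quotient-≮ r<n e)
  ... | Tri.tri≈ _ refl _ = ℤ.+-injective (+-cancelʳ-≡ (q * + n) e)
  ... | Tri.tri> _ _ q′<q = contradiction q′<q (quotient-≮ r′<n (sym e))

  %ℕ-≋ : ∀ i → i ≋ + (i %ℕ n)
  %ℕ-≋ i = by (i /ℕ n) (a≡a%ℕn+[a/ℕn]*n i n)

  ≋⇒%ℕ : ∀ {i} {r} → i ≋ + r → r ℕ.< n → i %ℕ n ≡ r
  ≋⇒%ℕ {i} (by q e) r<n =
    remainder-unique {q = i /ℕ n} {q} (n%ℕd<d i n) r<n (trans (sym (a≡a%ℕn+[a/ℕn]*n i n)) e)

  %ℕ-cong : ∀ {i j} → i ≋ j → i %ℕ n ≡ j %ℕ n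
  %ℕ-cong {i} {j} h = ≋⇒%ℕ (≋-trans h (%ℕ-≋ j)) (n%ℕd<d j n)

⊕-cancel : ∀ a b → (a ⊖ b) ⊕ b ≡ a
⊕-cancel (x , y) (x′ , y′) = cong₂ _,_ (ring x x′) (ring y y′)
  where
  ring : ∀ x x′ → x - x′ + x′ ≡ x
  ring = solve-∀

⊕-⊖ : ∀ a b → (a ⊕ b) ⊖ b ≡ a
⊕-⊖ (x , y) (x′ , y′) = cong₂ _,_ (ring x x′) (ring y y′)
  where
  ring : ∀ x x′ → x + x′ - x′ ≡ x
  ring = solve-∀

⊕-swap : ∀ a b c → a ⊕ b ⊕ c ≡ a ⊕ c ⊕ b
⊕-swap (x , y) (x′ , y′) (x″ , y″) = cong₂ _,_ (ring x x′ x″) (ring y y′ y″)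
  where
  ring : ∀ x x′ x″ → x + x′ + x″ ≡ x + x″ + x′
  ring = solve-∀

⊕-identityʳ : ∀ a → a ⊕ origin ≡ a
⊕-identityʳ (x , y) = cong₂ _,_ (ℤ.+-identityʳ x) (ℤ.+-identityʳ y)

⊖-origin : ∀ a → a ⊖ origin ≡ a
⊖-origin (x , y) = cong₂ _,_ (ℤ.+-identityʳ x) (ℤ.+-identityʳ y)

antidiagonal : Point → ℤ
antidiagonal (x , y) = x + y

antidiagonal-⊕ : ∀ a b → antidiagonal (a ⊕ b) ≡ antidiagonal a + antidiagonal b
antidiagonal-⊕ (x , y) (x′ , y′) = ring x y x′ y′
  where
  ring : ∀ x y x′ y′ → x + x′ + (y + y′) ≡ x + y + (x′ + y′)
  ring = solve-∀

antidiagonal-vec : ∀ a → antidiagonal (vec a) ≡ 1ℤ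
antidiagonal-vec R = refl
antidiagonal-vec U = refl

-- Lattice paths

module Path {n k : ℕ} .{{_ : NonZero n}} (P : LatticePath k n) where

  open Congruence n
  open Remainder n

  T : Point
  T = translation k n

  step-≋ : ∀ {i j} → i ≋ j → step P i ≡ step P j
  step-≋ {i} {j} h = cong (lookup (steps P))
    (Fin.fromℕ<-cong _ _ (%ℕ-cong (≋-+ (- 1ℤ) h)) (n%ℕd<d (i - 1ℤ) n) (n%ℕd<d (j - 1ℤ) n))

  vertex-step : ∀ i → vertex P i ≡ vertex P (i - 1ℤ) ⊕ vec (step P i)
  vertex-step (+ zero)       = sym (⊕-cancel origin (vec (step P 0ℤ)))
  vertex-step +[1+ m ]       = refl
  vertex-step -[1+ m ]       = trans
    (sym (⊕-cancel (vertex P -[1+ m ]) (vec (step P -[1+ m ]))))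
    -- `-[1+ m ] - 1ℤ` computes to `-[1+ suc (m + 0) ]`, whence the correction of `m`.
    (cong (λ t → vertex P -[1+ suc t ] ⊕ vec (step P -[1+ m ])) (sym (ℕ.+-identityʳ m)))

  vertex-next : ∀ i → vertex P (i + 1ℤ) ≡ vertex P i ⊕ vec (step P (i + 1ℤ))
  vertex-next i = trans (vertex-step (i + 1ℤ))
    (cong (λ t → vertex P t ⊕ vec (step P (i + 1ℤ))) (i+1-1 i))

  walk-vertex : ∀ {m} (as : Vec Step m) i →
    (∀ t → step P (i + + suc (toℕ t)) ≡ lookup as t) → walk (vertex P i) as ≡ vertex P (i + + m)
  walk-vertex []       i h = cong (vertex P) (sym (ℤ.+-identityʳ i))
  walk-vertex {suc m} (a ∷ as) i h = begin
    walk (vertex P i ⊕ vec a) as     ≡⟨ cong (λ v → walk v as)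
        (sym (trans (vertex-next i) (cong (λ s → vertex P i ⊕ vec s) (h fzero)))) ⟩
    walk (vertex P (i + 1ℤ)) as      ≡⟨ walk-vertex as (i + 1ℤ)
        (λ t → trans (cong (step P) (ℤ.+-assoc i 1ℤ (+ suc (toℕ t)))) (h (fsuc t))) ⟩
    vertex P (i + 1ℤ + + m)          ≡⟨ cong (vertex P) (ℤ.+-assoc i 1ℤ (+ m)) ⟩
    vertex P (i + + suc m)           ∎
    where open ≡-Reasoning

  step-lookup : ∀ t → step P (+ suc (toℕ t)) ≡ lookup (steps P) t
  step-lookup t = cong (lookup (steps P)) (trans
    (Fin.fromℕ<-cong _ _ (m<n⇒m%n≡m (Fin.toℕ<n t)) (n%ℕd<d (+ toℕ t) n) (Fin.toℕ<n t))
    (Fin.fromℕ<-toℕ t (Fin.toℕ<n t)))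

  vertex-n : vertex P (+ n) ≡ T
  vertex-n = trans (sym (walk-vertex (steps P) 0ℤ step-lookup)) (LatticePath.end P)

  -- The displacement over n steps does not depend on the starting point, because the steps are
  -- periodic; from 0 it is the end of the path.
  vertex-shift : ∀ i → vertex P (i + + n) ≡ vertex P i ⊕ T
  vertex-shift i = trans (sym (⊕-cancel (vertex P (i + + n)) (vertex P i)))
    (trans (cong (_⊕ vertex P i) (trans (shift-invariant φ φ-step i) φ-zero))
        (⊕-comm T (vertex P i)))
    where
    φ : ℤ → Point
    φ i = vertex P (i + + n) ⊖ vertex P i
    ⊕-comm : ∀ a b → a ⊕ b ≡ b ⊕ a
    ⊕-comm (x , y) (x′ , y′) = cong₂ _,_ (ℤ.+-comm x x′) (ℤ.+-comm y y′)
    ⊖-⊕ : ∀ a b c → (a ⊕ c) ⊖ (b ⊕ c) ≡ a ⊖ b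
    ⊖-⊕ (x , y) (x′ , y′) (x″ , y″) = cong₂ _,_ (ring x x′ x″) (ring y y′ y″)
      where
      ring : ∀ x x′ x″ → x + x″ - (x′ + x″) ≡ x - x′
      ring = solve-∀
    ring : ∀ i n → i + 1ℤ + n ≡ i + n + 1ℤ
    ring = solve-∀
    φ-step : ∀ i → φ (i + 1ℤ) ≡ φ i
    φ-step i = trans (cong₂ _⊖_
      (trans (cong (vertex P) (ring i (+ n))) (trans (vertex-next (i + + n))
        (cong (λ s → vertex P (i + + n) ⊕ vec s) (step-≋ (≋-+ 1ℤ (≋-period i))))))
      (vertex-next i)) (⊖-⊕ (vertex P (i + + n)) (vertex P i) _)
    φ-zero : φ 0ℤ ≡ T
    φ-zero = trans (cong (_⊖ origin) vertex-n) (⊖-origin T)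

  -- Each step raises x + y by 1. Labels can therefore be read off coordinates, which makes the
  -- positions on different cuts comparable.
  antidiagonal-vertex : ∀ i → antidiagonal (vertex P i) ≡ i
  antidiagonal-vertex i = trans (ring (antidiagonal (vertex P i)) i)
    (trans (cong (_+ i) (shift-invariant φ φ-step i)) (ℤ.+-identityˡ i))
    where
    φ : ℤ → ℤ
    φ i = antidiagonal (vertex P i) - i
    ring : ∀ a i → a ≡ a - i + i
    ring = solve-∀
    ring′ : ∀ a i → a + 1ℤ - (i + 1ℤ) ≡ a - i
    ring′ = solve-∀
    φ-step : ∀ i → φ (i + 1ℤ) ≡ φ i
    φ-step i = trans (cong (_- (i + 1ℤ)) (trans (cong antidiagonal (vertex-next i))
      (trans (antidiagonal-⊕ (vertex P i) _)
          (cong (λ t → antidiagonal (vertex P i) + t) (antidiagonal-vec (step P (i + 1ℤ)))))))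
      (ring′ (antidiagonal (vertex P i)) i)

  x-mono : ∀ {i j} → i ℤ.≤ j → proj₁ (vertex P i) ℤ.≤ proj₁ (vertex P j)
  x-mono = mono-from-step (proj₁ ∘ vertex P) λ i →
    subst (λ v → proj₁ (vertex P i) ℤ.≤ proj₁ v) (sym (vertex-next i))
        (up (vertex P i) (step P (i + 1ℤ)))
    where
    up : ∀ v a → proj₁ v ℤ.≤ proj₁ (v ⊕ vec a)
    up v R = ℤ.<⇒≤ (i<i+1 (proj₁ v))
    up v U = ℤ.≤-reflexive (sym (ℤ.+-identityʳ (proj₁ v)))

  y-mono : ∀ {i j} → i ℤ.≤ j → proj₂ (vertex P i) ℤ.≤ proj₂ (vertex P j)
  y-mono = mono-from-step (proj₂ ∘ vertex P) λ i →
    subst (λ v → proj₂ (vertex P i) ℤ.≤ proj₂ v) (sym (vertex-next i))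
        (up (vertex P i) (step P (i + 1ℤ)))
    where
    up : ∀ v a → proj₂ v ℤ.≤ proj₂ (v ⊕ vec a)
    up v U = ℤ.<⇒≤ (i<i+1 (proj₂ v))
    up v R = ℤ.≤-reflexive (sym (ℤ.+-identityʳ (proj₂ v)))

  x-after-R : ∀ {i j} → step P i ≡ R → i < j → proj₁ (start P i) < proj₁ (start P j)
  x-after-R {i} {j} r i<j = ℤ.<-≤-trans
    (subst (λ v → proj₁ (start P i) < proj₁ v)
      (sym (trans (vertex-step i) (cong (λ s → vertex P (i - 1ℤ) ⊕ vec s) r)))
          (i<i+1 (proj₁ (start P i))))
    (x-mono (<⇒≤-1 i<j))

  y-after-U : ∀ {i j} → step P i ≡ U → i < j → proj₂ (start P i) < proj₂ (start P j)
  y-after-U {i} {j} u i<j = ℤ.<-≤-trans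
    (subst (λ v → proj₂ (start P i) < proj₂ v)
      (sym (trans (vertex-step i) (cong (λ s → vertex P (i - 1ℤ) ⊕ vec s) u)))
          (i<i+1 (proj₂ (start P i))))
    (y-mono (<⇒≤-1 i<j))

  -- Let j be the R-step under the box. A vertical boundary edge before j starts below the start of
  -- j, and an edge after j starts strictly to the right of the column.
  southern-≢-left : ∀ i {b} → InStrip P b → southern P i ≢ left b
  southern-≢-left i {b} record { index = j ; isR = r ; column = c ; above = a } e
    with ℤ.<-cmp i j
  ... | Tri.tri< i<j _ _ = ℤ.<-irrefl refl (ℤ.<-≤-trans (y-after-U (cong proj₁ e) i<j)
          (ℤ.≤-trans a (ℤ.≤-reflexive (sym (cong (proj₂ ∘ proj₂) e)))))
  ... | Tri.tri≈ _ refl _ = contradiction (trans (sym r) (cong proj₁ e)) λ ()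
  ... | Tri.tri> _ _ j<i = ℤ.<-irrefl (sym (trans (cong (proj₁ ∘ proj₂) e) c)) (x-after-R r j<i)

  -- The only horizontal boundary edge in the column of the box is the step under it, which is lower
  -- than the top.
  southern-≢-top : ∀ i {b} → InStrip P b → southern P i ≢ top b
  southern-≢-top i {b} record { index = j ; isR = r ; column = c ; above = a } e
    with ℤ.<-cmp i j
  ... | Tri.tri< i<j _ _ = ℤ.<-irrefl x-eq (x-after-R (cong proj₁ e) i<j)
    where
    x-eq : proj₁ (start P i) ≡ proj₁ (start P j)
    x-eq = trans (cong (proj₁ ∘ proj₂) e) (trans (ℤ.+-identityʳ (proj₁ b)) c)
  ... | Tri.tri≈ _ refl _ = ℤ.<-irrefl refl (ℤ.<-≤-trans (i<i+1 (proj₂ b))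
          (ℤ.≤-trans (ℤ.≤-reflexive (sym (cong (proj₂ ∘ proj₂) e))) a))
  ... | Tri.tri> _ _ j<i = ℤ.<-irrefl (sym x-eq) (x-after-R r j<i)
    where
    x-eq : proj₁ (start P i) ≡ proj₁ (start P j)
    x-eq = trans (cong (proj₁ ∘ proj₂) e) (trans (ℤ.+-identityʳ (proj₁ b)) c)

  all-R⇒k≡0 : (∀ i → step P i ≡ R) → k ≡ 0
  all-R⇒k≡0 allR = ℤ.+-injective (trans (cong proj₂ (sym vertex-n))
    (shift-invariant φ (λ i → trans
      (cong proj₂ (trans (vertex-next i) (cong (λ s → vertex P i ⊕ vec s) (allR (i + 1ℤ)))))
      (ℤ.+-identityʳ (φ i))) (+ n)))
    where
    φ : ℤ → ℤ
    φ i = proj₂ (vertex P i)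

  no-boxes : (∀ i → step P i ≡ R) → ∀ {b} → ¬ InStrip P b
  no-boxes allR {b} record { index = j ; above = a ; below = l } = ℤ.<-irrefl refl (ℤ.≤-<-trans a
    (subst (proj₂ b <_) (trans (cong (λ t → proj₂ (start P j) + + t) (all-R⇒k≡0 allR))
      (ℤ.+-identityʳ (proj₂ (start P j)))) l))

-- Parity and order

odd : ℕ → Bool
odd zero    = false
odd (suc m) = not (odd m)

odd-+ : ∀ m m′ → odd (m ℕ.+ m′) ≡ odd m xor odd m′
odd-+ zero    m′ = refl
odd-+ (suc m) m′ = trans (cong not (odd-+ m m′)) (not-xor (odd m) (odd m′))
  where
  not-xor : ∀ a b → not (a xor b) ≡ not a xor b
  not-xor false b = refl
  not-xor true  b = not-involutive b

2∣⇒even : ∀ {m} → 2 ℕ.∣ m → odd m ≡ false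
2∣⇒even (ℕ.divides q refl) = double q
  where
  double : ∀ q → odd (q ℕ.* 2) ≡ false
  double zero    = refl
  double (suc q) = trans (not-involutive (odd (q ℕ.* 2))) (double q)

even⇒2∣ : ∀ m → odd m ≡ false → 2 ℕ.∣ m
even⇒2∣ zero          e = 2 ℕ.∣0
even⇒2∣ (suc (suc m)) e =
  ℕ.∣m∣n⇒∣m+n ℕ.∣-refl (even⇒2∣ m (trans (sym (not-involutive (odd m))) e))

length-filter-cong : ∀ {A : Set} {P Q : A → Set} (P? : ∀ x → Dec (P x)) (Q? : ∀ x → Dec (Q x)) xs →
  (∀ {x} → x ∈ xs → P x ⇔ Q x) → length (filter P? xs) ≡ length (filter Q? xs)
length-filter-cong P? Q? []       h = refl
length-filter-cong P? Q? (x ∷ xs) h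
  with P? x | Q? x | length-filter-cong P? Q? xs (h ∘ there)
... | yes _ | yes _ | ih = cong suc ih
... | no _  | no _  | ih = ih
... | yes p | no ¬q | _  = contradiction (⇒ (h (here refl)) p) ¬q
... | no ¬p | yes q | _  = contradiction (⇐ (h (here refl)) q) ¬p

-- Boolean, so that reversals of order compose by `xor` with parities of crossings.
before : ℤ → ℤ → Bool
before i j = does (i ℤ.<? j)

before-true : ∀ {i j} → i < j → before i j ≡ true
before-true {i} {j} = dec-true (i ℤ.<? j)

before⇒< : ∀ {i j} → before i j ≡ true → i < j
before⇒< {i} {j} e with i ℤ.<? j
... | yes i<j = i<j
before⇒< () | no _

before-flip : ∀ {i j} → i ≢ j → before j i ≡ not (before i j)
before-flip {i} {j} i≢j with ℤ.<-cmp i j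
... | Tri.tri< i<j _ j≮i = trans (dec-false (j ℤ.<? i) j≮i) (cong not (sym (before-true i<j)))
... | Tri.tri≈ _ i≡j _   = contradiction i≡j i≢j
... | Tri.tri> i≮j _ j<i = trans (before-true j<i) (cong not (sym (dec-false (i ℤ.<? j) i≮j)))

stepTo : Point → Point → Step
stepTo p q = if does (proj₁ p ℤ.≟ proj₁ q) then U else R

stepTo-vec : ∀ p a → stepTo p (p ⊕ vec a) ≡ a
stepTo-vec (x , _) U = cong (if_then U else R) (dec-true (x ℤ.≟ x + 0ℤ) (sym (ℤ.+-identityʳ x)))
stepTo-vec (x , _) R = cong (if_then U else R) (dec-false (x ℤ.≟ x + 1ℤ) (ℤ.<⇒≢ (i<i+1 x)))

-- Cuts of the strip and strands

module Regions {n k : ℕ} (1<n : 1 ℕ.< n) .{{_ : NonZero n}} (P : LatticePath k n) where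

  open Congruence n
  open Words n 1<n
  open Affine
  open Path P using (T)

  -- The vertices of a periodic path across the strip. That consecutive ones are
  -- adjacent only matters next to a flipped box, where Flip demands it.
  record Cut : Set where
    field
      vtx      : ℤ → Point
      level    : ∀ i → antidiagonal (vtx i) ≡ i
      periodic : ∀ i → vtx (i + + n) ≡ vtx i ⊕ T

  open Cut

  edge : Cut → ℤ → Edge
  edge Q i = stepTo (vtx Q (i - 1ℤ)) (vtx Q i) , vtx Q (i - 1ℤ)

  edge-intro : ∀ Q i {b} a → vtx Q (i - 1ℤ) ≡ b → vtx Q i ≡ b ⊕ vec a → edge Q i ≡ (a , b)
  edge-intro Q i {b} a e e′ = cong₂ _,_ (trans (cong₂ stepTo e e′) (stepTo-vec b a)) e

  edge-cong : ∀ Q Q′ i → vtx Q (i - 1ℤ) ≡ vtx Q′ (i - 1ℤ) → vtx Q i ≡ vtx Q′ i →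
    edge Q i ≡ edge Q′ i
  edge-cong Q Q′ i e e′ = cong₂ _,_ (cong₂ stepTo e e′) e

  -- Edge i of any cut starts on the antidiagonal i - 1.
  edge-injective : ∀ Q Q′ {i j} → edge Q i ≡ edge Q′ j → i ≡ j
  edge-injective Q Q′ {i} {j} e = +-cancelʳ-≡ (- 1ℤ) (trans (sym (level Q (i - 1ℤ)))
    (trans (cong (antidiagonal ∘ proj₂) e) (level Q′ (j - 1ℤ))))

  -- Q passes above a box and its translates, Q′ below them, and they agree elsewhere.
  record Flip (Q : Cut) (p : ℤ) (Q′ : Cut) : Set where
    field
      up     : ∀ {i} → i ≋ p → vtx Q i ≡ vtx Q (i - 1ℤ) ⊕ vec U
      across : ∀ {i} → i ≋ p → vtx Q (i + 1ℤ) ≡ vtx Q i ⊕ vec R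
      pushed : ∀ {i} → i ≋ p → vtx Q′ i ≡ vtx Q (i - 1ℤ) ⊕ vec R
      inside : ∀ {i} → i ≋ p → InStrip P (vtx Q (i - 1ℤ))
      away   : ∀ {i} → ¬ i ≋ p → vtx Q′ i ≡ vtx Q i

    private
      pred-away : ∀ {i} → i ≋ p → ¬ i - 1ℤ ≋ p
      pred-away {i} a b = +1-≋-absurd 1<n (≋-trans (≋-reflexive (i-1+1 i)) (≋-trans a (≋-sym b)))

      suc-away : ∀ {i} → i ≋ p → ¬ i + 1ℤ ≋ p
      suc-away a b = +1-≋-absurd 1<n (≋-trans b (≋-sym a))

    -- Above the box the positions i and i + 1 are its left and top edges, below it they are its
    -- bottom and right edges. Hence a crossing exchanges the positions and an elbow keeps them.
    left-edge : ∀ {i} → i ≋ p → edge Q i ≡ left (vtx Q (i - 1ℤ))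
    left-edge {i} a = edge-intro Q i U refl (up a)

    top-edge : ∀ {i} → i ≋ p → edge Q (i + 1ℤ) ≡ top (vtx Q (i - 1ℤ))
    top-edge {i} a = edge-intro Q (i + 1ℤ) R e (trans (across a) (cong (_⊕ vec R) (up a)))
      where
      e = trans (cong (vtx Q) (i+1-1 i)) (up a)

    bottom-edge : ∀ {i} → i ≋ p → edge Q′ i ≡ bottom (vtx Q (i - 1ℤ))
    bottom-edge {i} a = edge-intro Q′ i R (away (pred-away a)) (pushed a)

    right-edge : ∀ {i} → i ≋ p → edge Q′ (i + 1ℤ) ≡ right (vtx Q (i - 1ℤ))
    right-edge {i} a = edge-intro Q′ (i + 1ℤ) U (trans (cong (vtx Q′) (i+1-1 i)) (pushed a))
      (trans (away (suc-away a)) (trans (across a) (trans (cong (_⊕ vec R) (up a))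
        (⊕-swap (vtx Q (i - 1ℤ)) (vec U) (vec R)))))

    away-edge : ∀ {i} → ¬ i ≋ p → ¬ i ≋ p + 1ℤ → edge Q i ≡ edge Q′ i
    away-edge {i} ¬a ¬b = edge-cong Q Q′ i
      (sym (away λ a → ¬b (≋-trans (≋-reflexive (sym (i-1+1 i))) (≋-+ 1ℤ a))))
      (sym (away ¬a))

  -- `done` asks only for pointwise equal vertices, as equal paths may arise from different
  -- constructions of a cut.
  data Region : Cut → Cut → Set where
    done : ∀ {Q Q′} → vtx Q ≗ vtx Q′ → Region Q Q′
    _∷_  : ∀ {Q p Q′ Q″} → Flip Q p Q′ → Region Q′ Q″ → Region Q Q″

  word : ∀ {Q Q′} → Region Q Q′ → List ℤ
  word (done _)        = []
  word (_∷_ {p = p} _ r) = p ∷ word r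

  -- `at-top` is indexed by i + 1 so that the same i names the box in both of its cases.
  data Place (p : ℤ) : ℤ → Set where
    at-left   : ∀ {i} → i ≋ p → Place p i
    at-top    : ∀ {i} → i ≋ p → Place p (i + 1ℤ)
    elsewhere : ∀ {i} → ¬ i ≋ p → ¬ i ≋ p + 1ℤ → Place p i

  place : ∀ p i → Place p i
  place p i with i ≋? p | i ≋? p + 1ℤ
  ... | yes a | _     = at-left a
  ... | no ¬a | yes b = subst (Place p) (i-1+1 i) (at-top (≋-pred b))
  ... | no ¬a | no ¬b = elsewhere ¬a ¬b

  boxAt : Cut → ∀ {p i} → Place p i → List Point
  boxAt Q (at-left {i} _)  = [ vtx Q (i - 1ℤ) ]
  boxAt Q (at-top {i} _)   = [ vtx Q (i - 1ℤ) ]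
  boxAt Q (elsewhere _ _)  = []

  data Flipped (b : Point) : ∀ {Q Q′} → Region Q Q′ → Set where
    here  : ∀ {Q p Q′ Q″} {fl : Flip Q p Q′} {r : Region Q′ Q″} {i} →
            i ≋ p → b ≡ vtx Q (i - 1ℤ) → Flipped b (fl ∷ r)
    there : ∀ {Q p Q′ Q″} {fl : Flip Q p Q′} {r : Region Q′ Q″} →
            Flipped b r → Flipped b (fl ∷ r)

  advance : ∀ {Q p Q′} → Flip Q p Q′ → ∀ i → proj₁ (vtx Q i) ℤ.≤ proj₁ (vtx Q′ i)
  advance {Q} {p} fl i with i ≋? p
  ... | no ¬a = ℤ.≤-reflexive (cong proj₁ (sym (Flip.away fl ¬a)))
  ... | yes a = subst₂ ℤ._≤_ (sym (cong proj₁ (Flip.up fl a))) (sym (cong proj₁ (Flip.pushed fl a)))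
                  (ℤ.+-monoʳ-≤ (proj₁ (vtx Q (i - 1ℤ))) (+≤+ ℕ.z≤n))

  -- Vertices on a fixed antidiagonal only move right (`advance`). When `b` is flipped, the vertex
  -- on the antidiagonal after that of `b` is its upper left corner, with the abscissa of `b`.
  flipped-bound : ∀ {Q Q′} {r : Region Q Q′} {b} → Flipped b r →
    proj₁ (vtx Q (antidiagonal b + 1ℤ)) ℤ.≤ proj₁ b
  flipped-bound {Q} (here {fl = fl} {i = i} a refl) = ℤ.≤-reflexive (trans
    (cong (proj₁ ∘ vtx Q) (trans (cong (_+ 1ℤ) (level Q (i - 1ℤ))) (i-1+1 i)))
    (trans (cong proj₁ (Flip.up fl a)) (ℤ.+-identityʳ (proj₁ (vtx Q (i - 1ℤ))))))
  flipped-bound (there {fl = fl} f) = ℤ.≤-trans (advance fl _) (flipped-bound f)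

  -- The flip moves that vertex to the lower right corner, one unit beyond the bound.
  flipped-once : ∀ {Q p Q′ Q″} (fl : Flip Q p Q′) (r : Region Q′ Q″) {i} → i ≋ p →
    ¬ Flipped (vtx Q (i - 1ℤ)) r
  flipped-once {Q} {Q′ = Q′} fl r {i} a f = ℤ.<-irrefl refl
      (ℤ.<-≤-trans (i<i+1 (proj₁ (vtx Q (i - 1ℤ))))
    (subst (ℤ._≤ proj₁ (vtx Q (i - 1ℤ))) (cong proj₁ (trans
      (cong (vtx Q′) (trans (cong (_+ 1ℤ) (level Q (i - 1ℤ))) (i-1+1 i))) (Flip.pushed fl a)))
      (flipped-bound f)))

  boxAt-class : ∀ Q {p i} (pl : Place p i) {b} → b ∈ boxAt Q pl → ∃[ j ] j ≋ p × b ≡ vtx Q (j - 1ℤ)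
  boxAt-class Q (at-left {i} a) (here e) = i , a , e
  boxAt-class Q (at-top {i} a)  (here e) = i , a , e

  boxAt-left : ∀ Q {p i} → i ≋ p → (pl : Place p i) → boxAt Q pl ≡ [ vtx Q (i - 1ℤ) ]
  boxAt-left Q a (at-left _)      = refl
  boxAt-left Q a (at-top b)       = contradiction (≋-trans a (≋-sym b)) (+1-≋-absurd 1<n)
  boxAt-left Q a (elsewhere ¬a _) = contradiction a ¬a

  boxAt-top : ∀ Q {p i j} → i ≋ p → j ≡ i + 1ℤ → (pl : Place p j) → boxAt Q pl ≡ [ vtx Q (i - 1ℤ) ]
  boxAt-top Q a e    (at-left b)      = contradiction
      (≋-trans (≋-reflexive (sym e)) (≋-trans b (≋-sym a))) (+1-≋-absurd 1<n)
  boxAt-top Q {i = i} a e (at-top {j} b)      = cong (λ t → [ vtx Q (t - 1ℤ) ])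
      (+-cancelʳ-≡ 1ℤ {j} {i} e)
  boxAt-top Q a e    (elsewhere _ ¬b) = contradiction (≋-trans (≋-reflexive e) (≋-+ 1ℤ a)) ¬b

  vtx-injective : ∀ Q i j → vtx Q (i - 1ℤ) ≡ vtx Q (j - 1ℤ) → i ≡ j
  vtx-injective Q i j e = +-cancelʳ-≡ (- 1ℤ)
    (trans (sym (level Q (i - 1ℤ))) (trans (cong antidiagonal e) (level Q (j - 1ℤ))))

  boxAt-shared : ∀ Q {p i j} (pl : Place p i) (pl′ : Place p j) → i ≢ j →
    ∀ {b} → b ∈ boxAt Q pl → b ∈ boxAt Q pl′ → swap p i ≡ j
  boxAt-shared Q (at-left {i} a) (at-left {j} _) i≢j (here e) (here e′) =
    contradiction (vtx-injective Q i j (trans (sym e) e′)) i≢j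
  boxAt-shared Q (at-left {i} a) (at-top {j} _) i≢j (here e) (here e′) =
    trans (swap-at a) (cong (_+ 1ℤ) (vtx-injective Q i j (trans (sym e) e′)))
  boxAt-shared Q (at-top {i} a) (at-left {j} _) i≢j (here e) (here e′) =
    trans (swap-at-+1 (≋-+ 1ℤ a)) (trans (i+1-1 i) (vtx-injective Q i j (trans (sym e) e′)))
  boxAt-shared Q (at-top {i} a) (at-top {j} _) i≢j (here e) (here e′) =
    contradiction (cong (_+ 1ℤ) (vtx-injective Q i j (trans (sym e) e′))) i≢j

  boxAt-swapped : ∀ Q {p i j} (pl : Place p i) (pl′ : Place p j) → i ≢ j → swap p i ≡ j →
    ∃[ l ] l ≋ p × boxAt Q pl ≡ [ vtx Q (l - 1ℤ) ] × boxAt Q pl′ ≡ [ vtx Q (l - 1ℤ) ]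
  boxAt-swapped Q (at-left {i} a) pl′ i≢j e =
    i , a , refl , boxAt-top Q a (trans (sym e) (swap-at a)) pl′
  boxAt-swapped Q (at-top {i} a) pl′ i≢j e with trans (sym e)
      (trans (swap-at-+1 (≋-+ 1ℤ a)) (i+1-1 i))
  ... | refl = i , a , refl , boxAt-left Q a pl′
  boxAt-swapped Q (elsewhere ¬a ¬b) pl′ i≢j e = contradiction (trans (sym (swap-off ¬a ¬b)) e) i≢j

  module _ (F : Filling P) where

    open Filling F using (tile)

    from-left : ∀ {b b′ d e} → d ≡ left b → Traverse P F b′ d e →
      b′ ≡ b × (tile b ≡ crossing × e ≡ right b ⊎ tile b ≡ elbow × e ≡ bottom b)
    from-left refl (left-right c)  = refl , inj₁ (c , refl)
    from-left refl (left-bottom c) = refl , inj₂ (c , refl)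

    from-top : ∀ {b b′ d e} → d ≡ top b → Traverse P F b′ d e →
      b′ ≡ b × (tile b ≡ crossing × e ≡ bottom b ⊎ tile b ≡ elbow × e ≡ right b)
    from-top e (left-right _)  = contradiction (cong proj₁ e) λ ()
    from-top e (left-bottom _) = contradiction (cong proj₁ e) λ ()
    from-top {b} {b′} e (top-bottom c) with trans (sym (⊕-⊖ b′ (vec U)))
        (trans (cong (λ t → proj₂ t ⊖ vec U) e) (⊕-⊖ b (vec U)))
    ... | refl = refl , inj₁ (c , refl)
    from-top {b} {b′} e (top-right c) with trans (sym (⊕-⊖ b′ (vec U)))
        (trans (cong (λ t → proj₂ t ⊖ vec U) e) (⊕-⊖ b (vec U)))
    ... | refl = refl , inj₂ (c , refl)

    tile-≋ : ∀ {Q p Q′} → Flip Q p Q′ → ∀ {i} → i ≋ p →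
      tile (vtx Q (i - 1ℤ)) ≡ tile (vtx Q (p - 1ℤ))
    tile-≋ {Q} {p} fl (by m refl) = trans (shift-invariant φ φ-step m)
      (cong (λ t → tile (vtx Q t)) (ring₀ p (+ n)))
      where
      φ : ℤ → Tile
      φ m = tile (vtx Q (p + m * + n - 1ℤ))
      ring₀ : ∀ p n → p + 0ℤ * n - 1ℤ ≡ p - 1ℤ
      ring₀ = solve-∀
      ring : ∀ p m n → p + (m + 1ℤ) * n - 1ℤ ≡ p + m * n - 1ℤ + n
      ring = solve-∀
      φ-step : ∀ m → φ (m + 1ℤ) ≡ φ m
      φ-step m = trans (cong tile (trans (cong (vtx Q) (ring p m (+ n))) (periodic Q _)))
                       (Filling.periodic F _ (Flip.inside fl (by m refl)))

    turn : ∀ {Q p Q′} → Flip Q p Q′ → Affine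
    turn {Q} {p} _ = act (tile (vtx Q (p - 1ℤ))) p

    -- `enters` also records that the traversal is forced by the entry edge; the uniqueness of
    -- strands comes from this field.
    data Outcome (e e′ : Edge) (i i′ : ℤ) : List Point → Set where
      passes : e ≡ e′ → i′ ≡ i → Outcome e e′ i i′ []
      enters : ∀ {b} → InStrip P b → Traverse P F b e e′ →
               (∀ {b′ e″} → Traverse P F b′ e e″ → b′ ≡ b × e″ ≡ e′) → Outcome e e′ i i′ [ b ]

    outcome : ∀ {Q p Q′} (fl : Flip Q p Q′) {i} (pl : Place p i) → let i′ = to (turn fl) i in
      Outcome (edge Q i) (edge Q′ i′) i i′ (boxAt Q pl)
    outcome {Q} {p} {Q′} fl (at-left {i} a) with tile (vtx Q (p - 1ℤ)) | tile-≋ fl a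
    ... | crossing | t = enters (inside a)
          (subst₂ (Traverse P F _) (sym (left-edge a)) (sym e′) (left-right t))
          (λ s → case (from-left (left-edge a) s))
      where
      open Flip fl
      e′ : edge Q′ (swap p i) ≡ right (vtx Q (i - 1ℤ))
      e′ = trans (cong (edge Q′) (swap-at a)) (right-edge a)
      case : ∀ {b′ e″} → _ → b′ ≡ _ × e″ ≡ _
      case (b≡ , inj₁ (_ , e)) = b≡ , trans e (sym e′)
      case (b≡ , inj₂ (t′ , _)) = contradiction (trans (sym t) t′) λ ()
    ... | elbow | t = enters (inside a)
          (subst₂ (Traverse P F _) (sym (left-edge a)) (sym (bottom-edge a)) (left-bottom t))
          (λ s → case (from-left (left-edge a) s))
      where
      open Flip fl
      case : ∀ {b′ e″} → _ → b′ ≡ _ × e″ ≡ _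
      case (b≡ , inj₂ (_ , e)) = b≡ , trans e (sym (bottom-edge a))
      case (b≡ , inj₁ (t′ , _)) = contradiction (trans (sym t) t′) λ ()
    outcome {Q} {p} {Q′} fl (at-top {i} a) with tile (vtx Q (p - 1ℤ)) | tile-≋ fl a
    ... | crossing | t = enters (inside a)
          (subst₂ (Traverse P F _) (sym (top-edge a)) (sym e′) (top-bottom t))
          (λ s → case (from-top (top-edge a) s))
      where
      open Flip fl
      e′ : edge Q′ (swap p (i + 1ℤ)) ≡ bottom (vtx Q (i - 1ℤ))
      e′ = trans (cong (edge Q′) (trans (swap-at-+1 (≋-+ 1ℤ a)) (i+1-1 i))) (bottom-edge a)
      case : ∀ {b′ e″} → _ → b′ ≡ _ × e″ ≡ _
      case (b≡ , inj₁ (_ , e)) = b≡ , trans e (sym e′)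
      case (b≡ , inj₂ (t′ , _)) = contradiction (trans (sym t) t′) λ ()
    ... | elbow | t = enters (inside a)
          (subst₂ (Traverse P F _) (sym (top-edge a)) (sym (right-edge a)) (top-right t))
          (λ s → case (from-top (top-edge a) s))
      where
      open Flip fl
      case : ∀ {b′ e″} → _ → b′ ≡ _ × e″ ≡ _
      case (b≡ , inj₂ (_ , e)) = b≡ , trans e (sym (right-edge a))
      case (b≡ , inj₁ (t′ , _)) = contradiction (trans (sym t) t′) λ ()
    outcome {Q} {p} {Q′} fl (elsewhere {i} ¬a ¬b) with tile (vtx Q (p - 1ℤ))
    ... | crossing = passes (trans (Flip.away-edge fl ¬a ¬b)
        (cong (edge Q′) (sym (swap-off ¬a ¬b)))) (swap-off ¬a ¬b)
    ... | elbow    = passes (Flip.away-edge fl ¬a ¬b) refl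

    infixr 5 _++ˢ_
    _++ˢ_ : ∀ {d e e′} → Strand P F d e → Strand P F e e′ → Strand P F d e′
    []      ++ˢ s′ = s′
    (t ∷ s) ++ˢ s′ = t ∷ (s ++ˢ s′)

    tiles : ∀ {Q Q′} (r : Region Q Q′) → Vec Tile (length (word r))
    tiles (done _) = []
    tiles (_∷_ {Q} {p} _ r) = tile (vtx Q (p - 1ℤ)) ∷ tiles r

    exit : ∀ {Q Q′} → Region Q Q′ → Affine
    exit r = run (word r) (tiles r)

    trail : ∀ {Q Q′} → Region Q Q′ → ℤ → List Point
    trail (done _)               i = []
    trail (_∷_ {Q} {p} fl r) i = boxAt Q (place p i) ++ trail r (to (turn fl) i)

    strand-across : ∀ {Q Q′} (r : Region Q Q′) i {d} → d ≡ edge Q i →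
      Σ[ s ∈ Strand P F d (edge Q′ (to (exit r) i)) ] boxes P F s ≡ trail r i
    strand-across {Q} {Q′} (done e) i {d} d≡ with trans d≡ (edge-cong Q Q′ i (e (i - 1ℤ)) (e i))
    ... | refl = [] , refl
    strand-across {Q} (_∷_ {p = p} fl r) i d≡ with boxAt Q (place p i) | outcome fl (place p i)
    ... | _ | passes e _   = strand-across r (to (turn fl) i) (trans d≡ e)
    strand-across {Q} (_∷_ {p = p} fl r) i refl | _ | enters h t _ =
      let s , q = strand-across r (to (turn fl) i) refl in (h , t) ∷ s , cong (_ ∷_) q

    -- The first box is split off to exclude the empty strand.
    NoReturn : Cut → Set
    NoReturn Q = ∀ {i j b d e e′} → d ≡ edge Q i → e′ ≡ edge Q j →
      InStrip P b → Traverse P F b d e → Strand P F e e′ → ⊥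

    -- A return to the upper cut is moved to the lower one: a flipped box at its beginning is
    -- deleted, and if it ends on an edge of a flipped box, that box is appended.
    noReturn : ∀ {Q Q′} → Region Q Q′ → NoReturn Q′ → NoReturn Q
    noReturn {Q} {Q′} (done c) nr {i} {j} e e′ =
      nr (trans e (edge-cong Q Q′ i (c (i - 1ℤ)) (c i)))
          (trans e′ (edge-cong Q Q′ j (c (j - 1ℤ)) (c j)))
    noReturn {Q} (_∷_ {p = p} {Q′ = Q₁} fl r) nr {i} {j} refl refl h t s
      with boxAt Q (place p i) in eqᵢ | outcome fl (place p i) | boxAt Q (place p j) in eqⱼ |
          outcome fl (place p j)
    ... | _ | passes e _ | _ | passes e′ _ = noReturn r nr e e′ h t s
    ... | _ | passes e _ | _ | enters h′ t′ _ = noReturn r nr e refl h t (s ++ˢ ((h′ , t′) ∷ []))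
    ... | _ | enters _ _ u | _ | _ with u t
    noReturn {Q} (_∷_ {p = p} {Q′ = Q₁} fl r) nr {i} {j} refl refl h t []
        | _ | enters _ _ u | _ | passes e e″ | refl , e′ =
      -- Nothing would remain of the strand. Then both positions have the same image under `turn`,
      -- although one enters a box and the other does not.
      contradiction (trans (sym eqᵢ) (trans (cong (λ z → boxAt Q (place p z)) i≡j) eqⱼ)) λ ()
      where
      i≡j : i ≡ j
      i≡j = injective (turn fl) (sym (edge-injective Q₁ Q₁ (trans (sym e) e′)))
    noReturn {Q} (_∷_ {p = p} {Q′ = Q₁} fl r) nr refl refl h t []
        | _ | enters _ _ u | _ | enters h′ t′ _ | refl , e′ = noReturn r nr e′ refl h′ t′ []
    noReturn {Q} (_∷_ {p = p} {Q′ = Q₁} fl r) nr refl refl h t ((h₂ , t₂) ∷ s)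
        | _ | enters _ _ u | _ | passes e _ | refl , e′ = noReturn r nr e′ e h₂ t₂ s
    noReturn {Q} (_∷_ {p = p} {Q′ = Q₁} fl r) nr refl refl h t ((h₂ , t₂) ∷ s)
        | _ | enters _ _ u | _ | enters h′ t′ _ | refl , e′ =
      noReturn r nr e′ refl h₂ t₂ (s ++ˢ ((h′ , t′) ∷ []))

    -- Every box is forced by its entry edge, so only the stopping point could differ. Stopping
    -- early or running on would make the longer of the two strands return to the lower cut.
    strand-unique : ∀ {Q Q′} (r : Region Q Q′) → NoReturn Q′ → ∀ {i j d e} →
      d ≡ edge Q i → e ≡ edge Q′ j → (s : Strand P F d e) →
      j ≡ to (exit r) i × boxes P F s ≡ trail r i
    strand-unique {Q} {Q′} (done c) nr {i} {j} refl e [] =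
      edge-injective Q′ Q (sym e) , refl
    strand-unique {Q} {Q′} (done c) nr {i} refl e ((h , t) ∷ s) =
      ⊥-elim (nr (edge-cong Q Q′ i (c (i - 1ℤ)) (c i)) e h t s)
    strand-unique {Q} {Q′} (_∷_ {p = p} fl r) nr {i} refl e s
      with boxAt Q (place p i) | outcome fl (place p i)
    ... | _ | passes e₁ _ = strand-unique r nr e₁ e s
    strand-unique {Q} {Q′} (_∷_ {p = p} fl r) nr {i} refl e []
        | _ | enters h t u = ⊥-elim (nr e refl h t (proj₁ (strand-across r (to (turn fl) i) refl)))
    strand-unique {Q} {Q′} (_∷_ {p = p} fl r) nr {i} refl e ((h₂ , t₂) ∷ s)
        | _ | enters h t u with u t₂
    ... | refl , e₂ = let j≡ , b≡ = strand-unique r nr e₂ e s in j≡ , cong (_ ∷_) b≡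

    trail-flipped : ∀ {Q Q′} (r : Region Q Q′) i {b} → b ∈ trail r i → Flipped b r
    trail-flipped (_∷_ {Q} {p} fl r) i m with ∈-++⁻ (boxAt Q (place p i)) m
    ... | inj₁ m₁ = let j , a , e = boxAt-class Q (place p i) m₁ in here a e
    ... | inj₂ m₂ = there (trail-flipped r (to (turn fl) i) m₂)

    -- Counting common crossings

    Shared : List Point → Point → Set
    Shared B b = tile b ≡ crossing × b ∈ B

    shared? : ∀ B b → Dec (Shared B b)
    shared? B b = (tile b ≟ᵀ crossing) ×-dec (b ∈? B)

    common : List Point → List Point → ℕ
    common A B = length (filter (shared? B) A)

    common-++ : ∀ A A′ B → common (A ++ A′) B ≡ common A B ℕ.+ common A′ B
    common-++ A A′ B = trans (cong length (filter-++ (shared? B) A A′))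
        (length-++ (filter (shared? B) A))

    common-cong : ∀ A {B B′} → (∀ {b} → b ∈ A → b ∈ B ⇔ b ∈ B′) → common A B ≡ common A B′
    common-cong A h = length-filter-cong (shared? _) (shared? _) A λ m →
      mk⇔ (λ (c , m′) → c , ⇒ (h m) m′) (λ (c , m′) → c , ⇐ (h m) m′)

    common-split : ∀ A A′ B B′ → (∀ {b} → b ∈ A → b ∉ B′) → (∀ {b} → b ∈ A′ → b ∉ B) →
      common (A ++ A′) (B ++ B′) ≡ common A B ℕ.+ common A′ B′
    common-split A A′ B B′ h h′ = trans (common-++ A A′ (B ++ B′)) (cong₂ ℕ._+_
      (common-cong A λ m → mk⇔ (λ m′ → left-part m (∈-++⁻ B m′)) ∈-++⁺ˡ)
      (common-cong A′ λ m → mk⇔ (λ m′ → right-part m (∈-++⁻ B m′)) (∈-++⁺ʳ B)))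
      where
      left-part : ∀ {b} → b ∈ A → b ∈ B ⊎ b ∈ B′ → b ∈ B
      left-part m (inj₁ m′) = m′
      left-part m (inj₂ m′) = contradiction m′ (h m)
      right-part : ∀ {b} → b ∈ A′ → b ∈ B ⊎ b ∈ B′ → b ∈ B′
      right-part m (inj₁ m′) = contradiction m′ (h′ m)
      right-part m (inj₂ m′) = m′

    common-none : ∀ A B → (∀ {b} → b ∈ A → tile b ≡ crossing → b ∉ B) → common A B ≡ 0
    common-none A B h = cong length (filter-none (shared? B) (All.tabulate λ m (c , m′) → h m c m′))

    common-singleton : ∀ {b} → tile b ≡ crossing → common [ b ] [ b ] ≡ 1
    common-singleton c = cong length (filter-accept (shared? _) (c , here refl))

    -- A crossing reverses two positions only by exchanging them, that is, when both lie on the same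
    -- flipped box, which is then their one common crossing.
    turn-parity : ∀ {Q p Q′} (fl : Flip Q p Q′) {i j} → i ≢ j →
      before (to (turn fl) i) (to (turn fl) j)
        ≡ odd (common (boxAt Q (place p i)) (boxAt Q (place p j))) xor before i j
    turn-parity {Q} {p} fl {i} {j} i≢j with tile (vtx Q (p - 1ℤ)) in eq
    ... | elbow = cong (λ c → odd c xor before i j)
        (sym (common-none (boxAt Q (place p i)) _ λ m c _ →
            let l , a , e = boxAt-class Q (place p i) m in
            contradiction (trans (sym c) (trans (cong tile e) (trans (tile-≋ fl a) eq))) λ ()))
    ... | crossing with swap p i ℤ.≟ j
    ...   | yes e = let l , a , e₁ , e₂ = boxAt-swapped Q (place p i) (place p j) i≢j e in begin
      before (swap p i) (swap p j)  ≡⟨ cong₂ before e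
          (trans (cong (swap p) (sym e)) (swap-involutive p i)) ⟩
      before j i                    ≡⟨ before-flip i≢j ⟩
      true xor before i j           ≡⟨ cong (λ c → odd c xor before i j)
          (common-singleton (trans (tile-≋ fl a) eq)) ⟨
      odd (common [ vtx Q (l - 1ℤ) ] [ vtx Q (l - 1ℤ) ]) xor before i j
                                    ≡⟨ cong₂ (λ A B → odd (common A B) xor before i j) e₁ e₂ ⟨
      odd (common (boxAt Q (place p i)) (boxAt Q (place p j))) xor before i j ∎
      where open ≡-Reasoning
    ...   | no ≢j = trans
      (does-⇔ (mk⇔ (swap-reflects-< p i≢j ≢j) (λ h → swap-mono p h ≢j)) (_ ℤ.<? _) (i ℤ.<? j))
      (cong (λ c → odd c xor before i j)
          (sym (common-none (boxAt Q (place p i)) (boxAt Q (place p j)) λ m _ m′ →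
        contradiction (boxAt-shared Q (place p i) (place p j) i≢j m m′) ≢j)))

    -- The count splits over the flips because, by `flipped-once`, a box of the first flip does not
    -- recur in the later trails.
    parity : ∀ {Q Q′} (r : Region Q Q′) {i j} → i ≢ j →
      before (to (exit r) i) (to (exit r) j) ≡ odd (common (trail r i) (trail r j)) xor before i j
    parity (done _) i≢j = refl
    parity (_∷_ {Q} {p} fl r) {i} {j} i≢j = begin
      before (to (exit r) i′) (to (exit r) j′)     ≡⟨ parity r (i≢j ∘ injective (turn fl)) ⟩
      odd c₁ xor before i′ j′                      ≡⟨ cong (odd c₁ xor_) (turn-parity fl i≢j) ⟩
      odd c₁ xor (odd c₀ xor before i j)           ≡⟨ xor-assoc (odd c₁) (odd c₀) (before i j) ⟨
      (odd c₁ xor odd c₀) xor before i j           ≡⟨ cong (_xor before i j)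
          (trans (xor-comm (odd c₁) (odd c₀)) (sym (odd-+ c₀ c₁))) ⟩
      odd (c₀ ℕ.+ c₁) xor before i j               ≡⟨ cong (λ c → odd c xor before i j)
        (common-split (boxAt Q (place p i)) (trail r i′) (boxAt Q (place p j)) (trail r j′)
          (λ m m′ → apart i m (trail-flipped r j′ m′))
          (λ m m′ → apart j m′ (trail-flipped r i′ m))) ⟨
      odd (common (boxAt Q (place p i) ++ trail r i′) (boxAt Q (place p j) ++ trail r j′)) xor
          before i j ∎
      where
      open ≡-Reasoning
      i′ = to (turn fl) i
      j′ = to (turn fl) j
      c₀ = common (boxAt Q (place p i)) (boxAt Q (place p j))
      c₁ = common (trail r i′) (trail r j′)
      apart : ∀ l {b} → b ∈ boxAt Q (place p l) → ¬ Flipped b r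
      apart l m f = let _ , a , e = boxAt-class Q (place p l) m in
        flipped-once fl r a (subst (λ b → Flipped b r) e f)

xor-true : ∀ {a b} → true ≡ a xor b → a ≡ false ⇔ b ≡ true
xor-true {false} {true}  e = mk⇔ (λ _ → refl) (λ _ → refl)
xor-true {true}  {false} e = mk⇔ (λ ()) (λ ())
xor-true {true}  {true}  ()
xor-true {false} {false} ()

xor-trueʳ : ∀ {a b} → b ≡ a xor true → a ≡ false ⇔ b ≡ true
xor-trueʳ {false} refl = mk⇔ (λ _ → refl) (λ _ → refl)
xor-trueʳ {true}  refl = mk⇔ (λ ()) (λ ())

-- Fillings as words

module Strip {n k : ℕ} (1<n : 1 ℕ.< n) .{{_ : NonZero n}} (P : LatticePath k n) where

  open Congruence n
  open Words n 1<n
  open Affine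
  open Path P
  open Regions 1<n P
  open Cut

  Flip-resp : ∀ {Q Q₁ p Q′} → vtx Q ≗ vtx Q₁ → Flip Q₁ p Q′ → Flip Q p Q′
  Flip-resp {Q} {Q₁} e fl = record
    { up     = λ {i} a → trans (e i) (trans (up a) (cong (_⊕ vec U) (sym (e (i - 1ℤ)))))
    ; across = λ {i} a → trans (e (i + 1ℤ)) (trans (across a) (cong (_⊕ vec R) (sym (e i))))
    ; pushed = λ {i} a → trans (pushed a) (cong (_⊕ vec R) (sym (e (i - 1ℤ))))
    ; inside = λ {i} a → subst (InStrip P) (sym (e (i - 1ℤ))) (inside a)
    ; away   = λ {i} ¬a → trans (away ¬a) (sym (e i))
    }
    where open Flip fl

  snoc : ∀ {Q Q₁ p Q′} → Region Q Q₁ → Flip Q₁ p Q′ → Region Q Q′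
  snoc (done e)  fl = Flip-resp e fl ∷ done (λ _ → refl)
  snoc (fl′ ∷ r) fl = fl′ ∷ snoc r fl

  -- Painting a filling from a word

  Painted : ∀ {Q Q′} → Region Q Q′ → Set
  Painted r = Vec Tile (length (word r))

  -- The corner of a box flipped at position i lies on the antidiagonal i - 1, so
  -- `antidiagonal b + 1ℤ` is the only candidate for i, and no search over translates is required.
  Hit : Cut → ℤ → Point → Set
  Hit Q p b = antidiagonal b + 1ℤ ≋ p × b ≡ vtx Q (antidiagonal b + 1ℤ - 1ℤ)

  hit? : ∀ Q p b → Dec (Hit Q p b)
  hit? Q p b = (antidiagonal b + 1ℤ ≋? p) ×-dec (b ≟ᴾ vtx Q (antidiagonal b + 1ℤ - 1ℤ))

  hit : ∀ Q {p i} → i ≋ p → Hit Q p (vtx Q (i - 1ℤ))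
  hit Q {p} {i} a = subst (_≋ p) (sym e) a , cong (λ t → vtx Q (t - 1ℤ)) (sym e)
    where
    e : antidiagonal (vtx Q (i - 1ℤ)) + 1ℤ ≡ i
    e = trans (cong (_+ 1ℤ) (level Q (i - 1ℤ))) (i-1+1 i)

  paint : ∀ {Q Q′} (r : Region Q Q′) → Painted r → Point → Tile
  -- A default for points that are not swept; once the region covers the strip, `_≈_` does not see
  -- it.
  paint (done _) [] b = crossing
  paint (_∷_ {Q} {p} fl r) (τ ∷ τs) b = if does (hit? Q p b) then τ else paint r τs b

  antidiagonal-T : ∀ b → antidiagonal (b ⊕ T) ≡ antidiagonal b + + n
  antidiagonal-T (x , y) = ring x y (+ n) (+ k)
    where
    ring : ∀ x y n k → x + (n - k) + (y + k) ≡ x + y + n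
    ring = solve-∀

  hit-periodic : ∀ Q p b → Hit Q p (b ⊕ T) ⇔ Hit Q p b
  hit-periodic Q p b = mk⇔
    (λ (a , e) → ≋-trans (≋-sym i≋) a ,
      trans (sym (⊕-⊖ b T)) (trans (cong (_⊖ T) (trans e v≡)) (⊕-⊖ (vtx Q (i - 1ℤ)) T)))
    (λ (a , e) → ≋-trans i≋ a , trans (cong (_⊕ T) e) (sym v≡))
    where
    i = antidiagonal b + 1ℤ
    ring : ∀ a n → a + n + 1ℤ ≡ a + 1ℤ + n
    ring = solve-∀
    ring′ : ∀ i n → i + n - 1ℤ ≡ i - 1ℤ + n
    ring′ = solve-∀
    i≡ : antidiagonal (b ⊕ T) + 1ℤ ≡ i + + n
    i≡ = trans (cong (_+ 1ℤ) (antidiagonal-T b)) (ring (antidiagonal b) (+ n))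
    i≋ : antidiagonal (b ⊕ T) + 1ℤ ≋ i
    i≋ = ≋-trans (≋-reflexive i≡) (≋-period i)
    v≡ : vtx Q (antidiagonal (b ⊕ T) + 1ℤ - 1ℤ) ≡ vtx Q (i - 1ℤ) ⊕ T
    v≡ = trans (cong (vtx Q) (trans (cong (_- 1ℤ) i≡) (ring′ i (+ n)))) (periodic Q (i - 1ℤ))

  paint-periodic : ∀ {Q Q′} (r : Region Q Q′) τs b → paint r τs (b ⊕ T) ≡ paint r τs b
  paint-periodic (done _) [] b = refl
  paint-periodic (_∷_ {Q} {p} fl r) (τ ∷ τs) b = cong₂ (if_then τ else_)
    (does-⇔ (hit-periodic Q p b) (hit? Q p (b ⊕ T)) (hit? Q p b)) (paint-periodic r τs b)

  painting : ∀ {Q Q′} (r : Region Q Q′) → Painted r → Filling P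
  painting r τs = record { tile = paint r τs ; periodic = λ b _ → paint-periodic r τs b }

  -- `paint` takes the first letter that hits a box. By `flipped-once`, no earlier letter claims a
  -- box of a later flip.
  tiles-of-painted : ∀ F {Q Q′} (r : Region Q Q′) τs →
    (∀ {b} → Flipped b r → Filling.tile F b ≡ paint r τs b) → tiles F r ≡ τs
  tiles-of-painted F (done _) [] h = refl
  tiles-of-painted F (_∷_ {Q} {p} fl r) (τ ∷ τs) h = cong₂ _∷_
    (trans (h (here {i = p} ≋-refl refl))
      (cong (if_then τ else paint r τs (vtx Q (p - 1ℤ))) (dec-true (hit? Q p _) (hit Q ≋-refl))))
    (tiles-of-painted F r τs λ {b} f → trans (h (there f))
      (cong (if_then τ else paint r τs b) (dec-false (hit? Q p b) λ (a , e) →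
        flipped-once fl r a (subst (λ c → Flipped c r) e f))))

  tiles-determine : ∀ F G {Q Q′} (r : Region Q Q′) → tiles F r ≡ tiles G r →
    ∀ {b} → Flipped b r → Filling.tile F b ≡ Filling.tile G b
  tiles-determine F G (fl ∷ r) e (here a refl) =
    trans (tile-≋ F fl a) (trans (proj₁ (∷-injective e)) (sym (tile-≋ G fl a)))
  tiles-determine F G (fl ∷ r) e (there f) = tiles-determine F G r (proj₂ (∷-injective e)) f

  tiles-cong : ∀ F G {Q Q′} (r : Region Q Q′) → _≈_ P F G → tiles F r ≡ tiles G r
  tiles-cong F G (done _)  e = refl
  tiles-cong F G (fl ∷ r) e = cong₂ _∷_ (e _ (Flip.inside fl ≋-refl)) (tiles-cong F G r e)

  shift-< : ∀ (g : Affine) {i p} → i ≋ p → to g p < to g (p + 1ℤ) → to g i < to g (i + 1ℤ)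
  shift-< g {p = p} (by m refl) h = subst₂ _<_ (sym (shift-* g p m))
    (trans (sym (shift-* g (p + 1ℤ) m)) (cong (to g) (ring p (m * + n)))) (ℤ.+-monoˡ-< (m * + n) h)
    where
    ring : ∀ p t → p + 1ℤ + t ≡ p + t + 1ℤ
    ring = solve-∀

  -- Distinguished fillings and distinguished words

  module Boundaries (N S : Cut)
    (northern≡ : ∀ i → northern P i ≡ edge N (i + + k))
    (southern≡ : ∀ i → southern P i ≡ edge S i) where

    module _ (F : Filling P) where

      open Filling F using (tile)

      -- A traversal starts at a left or top edge of a strip box, and no southern edge is one.
      southern-final : NoReturn F S
      southern-final {i} d≡ _ h (left-right _) _  = southern-≢-left i h
          (trans (southern≡ i) (sym d≡))
      southern-final {i} d≡ _ h (left-bottom _) _ = southern-≢-left i h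
          (trans (southern≡ i) (sym d≡))
      southern-final {i} d≡ _ h (top-bottom _) _  = southern-≢-top i h
          (trans (southern≡ i) (sym d≡))
      southern-final {i} d≡ _ h (top-right _) _   = southern-≢-top i h
          (trans (southern≡ i) (sym d≡))

      returnless : ∀ {Q} → Region Q S → NoReturn F Q
      returnless r = noReturn F r southern-final

      exit-snoc : ∀ {Q Q₁ p Q′} (r : Region Q Q₁) (fl : Flip Q₁ p Q′) →
        to (exit F (snoc r fl)) ≗ to (turn F fl) ∘ to (exit F r)
      exit-snoc {p = p} (done e)  fl i = cong (λ v → to (act (tile v) p) i) (e (p - 1ℤ))
      exit-snoc (fl′ ∷ r) fl i = exit-snoc r fl (to (turn F fl′) i)

      exit-snoc-from : ∀ {Q Q₁ p Q′} (r : Region Q Q₁) (fl : Flip Q₁ p Q′) →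
        from (exit F r) ∘ to (turn F fl) ≗ from (exit F (snoc r fl))
      exit-snoc-from {Q₁ = Q₁} {p} r fl i = trans
          (cong (from (exit F r)) (from-act (tile (vtx Q₁ (p - 1ℤ))) p i))
        (sym (from-cong (exit F (snoc r fl)) (turn F fl ∙ exit F r) (exit-snoc r fl) i))

      module _ {Q : Cut} (r : Region N Q) (nr : NoReturn F Q) where

        -- To draw an ascent from `Distinguished`, strands arriving at the box must be exhibited;
        -- the permutation is onto, so they exist.
        strand-to : ∀ i {e} → e ≡ edge Q i → ∃[ l ] Strand P F (northern P l) e
        strand-to i {e} e≡ = l , subst (Strand P F (northern P l)) (sym e≡′)
            (proj₁ (strand-across F r (l + + k) (northern≡ l)))
          where
          l = from (exit F r) i - + k
          ring : ∀ a k → a - k + k ≡ a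
          ring = solve-∀
          e≡′ : e ≡ edge Q (to (exit F r) (l + + k))
          e≡′ = trans e≡ (cong (edge Q) (trans (sym (to-from (exit F r) i))
            (cong (to (exit F r)) (sym (ring (from (exit F r) i) (+ k))))))

        -- The strands arrive at z and z + 1 in increasing order, so by `parity` an even count means
        -- that they entered in this order. Their entrances are the values of the inverse of `exit`.
        crossings-before : ∀ {z d e} i j → d ≡ edge Q z → e ≡ edge Q (z + 1ℤ) →
          (p : Strand P F (northern P i) d) (q : Strand P F (northern P j) e) →
          2 ℕ.∣ crossings P F p q ⇔ from (exit F r) z < from (exit F r) (z + 1ℤ)
        crossings-before {z} i j d≡ e≡ p q
          with strand-unique F r nr (northern≡ i) d≡ p | strand-unique F r nr (northern≡ j) e≡ q
        ... | z≡ , p≡ | z+1≡ , q≡ = mk⇔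
          (λ h → subst₂ _<_ (back z≡) (back z+1≡)
              (before⇒< (⇒ order (2∣⇒even (subst (2 ℕ.∣_) c≡ h)))))
          (λ h → subst (2 ℕ.∣_) (sym c≡) (even⇒2∣ _
              (⇐ order (before-true (subst₂ _<_ (sym (back z≡)) (sym (back z+1≡)) h)))))
          where
          c≡ : crossings P F p q ≡ common F (trail F r (i + + k)) (trail F r (j + + k))
          c≡ = cong₂ (common F) p≡ q≡
          back : ∀ {y l} → y ≡ to (exit F r) l → l ≡ from (exit F r) y
          back {l = l} refl = sym (from-to (exit F r) l)
          i≢j : i + + k ≢ j + + k
          i≢j e = ℤ.<⇒≢ (i<i+1 z) (trans z≡ (trans (cong (to (exit F r)) e) (sym z+1≡)))
          order = xor-true (trans (sym (trans (cong₂ before (sym z≡) (sym z+1≡))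
              (before-true (i<i+1 z))))
                  (parity F r i≢j))

      module _ {Q : Cut} (r : Region Q S) where

        strand-from : ∀ i {d} → d ≡ edge Q i → ∃[ j ] Strand P F d (southern P j)
        strand-from i d≡ = to (exit F r) i , subst (Strand P F _) (sym (southern≡ _))
            (proj₁ (strand-across F r i d≡))

        -- Here the order at the start is known and `parity` decides the order at the exit.
        crossings-after : ∀ {z d e} i j → d ≡ edge Q z → e ≡ edge Q (z + 1ℤ) →
          (p : Strand P F d (southern P i)) (q : Strand P F e (southern P j)) →
          2 ℕ.∣ crossings P F p q ⇔ to (exit F r) z < to (exit F r) (z + 1ℤ)
        crossings-after {z} i j d≡ e≡ p q
          with strand-unique F r southern-final d≡ (southern≡ i) p | strand-unique F r
              southern-final e≡ (southern≡ j) q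
        ... | _ , p≡ | _ , q≡ = mk⇔
          (λ h → before⇒< (⇒ order (2∣⇒even (subst (2 ℕ.∣_) c≡ h))))
          (λ h → subst (2 ℕ.∣_) (sym c≡) (even⇒2∣ _ (⇐ order (before-true h))))
          where
          c≡ : crossings P F p q ≡ common F (trail F r z) (trail F r (z + 1ℤ))
          c≡ = cong₂ (common F) p≡ q≡
          order = xor-trueʳ (trans (parity F r (ℤ.<⇒≢ (i<i+1 z)))
                  (cong (odd (common F (trail F r z) (trail F r (z + 1ℤ))) xor_)
                      (before-true (i<i+1 z))))

      -- `r₁` is the part already swept, and `g` is the product of its letters, the map from current
      -- positions back to entrances.
      distinguished⇒word : ∀ {Q} (r₁ : Region N Q) (r : Region Q S) g → to g ≗ from (exit F r₁) →
        Distinguished P F → DistinguishedFrom g (word r) (tiles F r)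
      distinguished⇒word r₁ (done _) g g≡ D = tt
      distinguished⇒word {Q} r₁ (_∷_ {p = p} fl r) g g≡ D =
        (λ elb → let i , s = strand-to r₁ nr p (sym (left-edge ≋-refl))
                     j , s′ = strand-to r₁ nr (p + 1ℤ) (sym (top-edge ≋-refl))
                 in subst₂ _<_ (sym (g≡ p)) (sym (g≡ (p + 1ℤ)))
                      (⇒ (crossings-before r₁ nr i j (sym (left-edge ≋-refl))
                          (sym (top-edge ≋-refl)) s s′)
                         (D (vtx Q (p - 1ℤ)) (inside ≋-refl) elb i j s s′))) ,
        distinguished⇒word (snoc r₁ fl) r (g ∙ turn F fl)
          (λ i → trans (g≡ (to (turn F fl) i)) (exit-snoc-from r₁ fl i)) D
        where
        open Flip fl
        nr = returnless (fl ∷ r)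

      word⇒distinguished : ∀ {Q} (r₁ : Region N Q) (r : Region Q S) g → to g ≗ from (exit F r₁) →
        DistinguishedFrom g (word r) (tiles F r) →
        ∀ {b} → Flipped b r → tile b ≡ elbow →
        ∀ i j (p : Strand P F (northern P i) (left b)) (q : Strand P F (northern P j) (top b)) → 2
            ℕ.∣ crossings P F p q
      word⇒distinguished r₁ (fl ∷ r) g g≡ (a , _) (here {i = z} z≋p refl) elb i j s s′ =
        ⇐ (crossings-before r₁ (returnless (fl ∷ r)) i j (sym (left-edge z≋p)) (sym (top-edge z≋p))
            s s′)
          (subst₂ _<_ (g≡ z) (g≡ (z + 1ℤ)) (shift-< g z≋p (a (trans (sym (tile-≋ F fl z≋p)) elb))))
        where open Flip fl
      word⇒distinguished r₁ (fl ∷ r) g g≡ (_ , d) (there f) elb i j s s′ =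
        word⇒distinguished (snoc r₁ fl) r (g ∙ turn F fl)
          (λ i → trans (g≡ (to (turn F fl) i)) (exit-snoc-from r₁ fl i)) d f elb i j s s′

      antiDistinguished⇒word : ∀ {Q} (r : Region Q S) → AntiDistinguished P F →
        AntiDistinguishedWord (word r) (tiles F r)
      antiDistinguished⇒word (done _) A = tt
      antiDistinguished⇒word {Q} (_∷_ {p = p} fl r) A =
        (λ elb → let i , s = strand-from r p (sym (bottom-edge ≋-refl))
                     j , s′ = strand-from r (p + 1ℤ) (sym (right-edge ≋-refl))
                 in ⇒ (crossings-after r i j (sym (bottom-edge ≋-refl)) (sym (right-edge ≋-refl)) s
                     s′)
                      (A (vtx Q (p - 1ℤ)) (inside ≋-refl) elb i j s s′)) ,
        antiDistinguished⇒word r A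
        where open Flip fl

      word⇒antiDistinguished : ∀ {Q} (r : Region Q S) → AntiDistinguishedWord (word r) (tiles F r) →
        ∀ {b} → Flipped b r → tile b ≡ elbow →
        ∀ i j (p : Strand P F (bottom b) (southern P i)) (q : Strand P F (right b) (southern P j)) →
            2 ℕ.∣ crossings P F p q
      word⇒antiDistinguished (fl ∷ r) (a , _) (here {i = z} z≋p refl) elb i j s s′ =
        ⇐ (crossings-after r i j (sym (bottom-edge z≋p)) (sym (right-edge z≋p)) s s′)
          (shift-< (exit F r) z≋p (a (trans (sym (tile-≋ F fl z≋p)) elb)))
        where open Flip fl
      word⇒antiDistinguished (fl ∷ r) (_ , d) (there f) elb i j s s′ =
        word⇒antiDistinguished r d f elb i j s s′

    module Correspondence (r : Region N S) (cover : ∀ {b} → InStrip P b → Flipped b r)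
      (f : AffinePermutation n) where

      -- Northern labels differ from positions by k, so the condition says that `exit` is
      -- `normalised k f`, the element of the affine Weyl group attached to f.
      strandPermutation⇔exit : ∀ F →
        HasStrandPermutation P F f ⇔ (∀ i → to (exit F r) (i + + k) ≡ fun f i)
      strandPermutation⇔exit F = mk⇔
        (λ h i → sym (proj₁ (strand-unique F r (southern-final F) (northern≡ i)
            (southern≡ (fun f i)) (h i))))
        (λ h i → subst (Strand P F (northern P i))
          (trans (cong (edge S) (h i)) (sym (southern≡ (fun f i))))
          (proj₁ (strand-across F r (i + + k) (northern≡ i))))

      tiles-painting : ∀ τs → tiles (painting r τs) r ≡ τs
      tiles-painting τs = tiles-of-painted (painting r τs) r τs λ _ → refl

      tiles-injective : ∀ F G → tiles F r ≡ tiles G r → _≈_ P F G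
      tiles-injective F G e b h = tiles-determine F G r e (cover h)

      repaint-permutation : ∀ F τs → to (run (word r) τs) ≗ to (exit F r) →
        HasStrandPermutation P F f → HasStrandPermutation P (painting r τs) f
      repaint-permutation F τs e h = ⇐ (strandPermutation⇔exit (painting r τs)) λ i →
        trans (cong (λ υs → to (run (word r) υs) (i + + k)) (tiles-painting τs))
          (trans (e (i + + k)) (⇒ (strandPermutation⇔exit F) h i))

      distinguished⇔ : ∀ F → Distinguished P F ⇔ DistinguishedFrom ε (word r) (tiles F r)
      distinguished⇔ F = mk⇔
        (distinguished⇒word F (done λ _ → refl) r ε λ _ → refl)
        (λ d b h → word⇒distinguished F (done λ _ → refl) r ε (λ _ → refl) d (cover h))

      antiDistinguished⇔ : ∀ F → AntiDistinguished P F ⇔ AntiDistinguishedWord (word r) (tiles F r)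
      antiDistinguished⇔ F = mk⇔ (antiDistinguished⇒word F r)
        (λ d b h → word⇒antiDistinguished F r d (cover h))

      open Setoid using (Carrier)

      toDeo : Carrier (AntiDeo f P) → Carrier (Deo f P)
      toDeo (F , h , A) = painting r τs , repaint-permutation F τs
          (run-distinguish (word r) (tiles F r)) h ,
        ⇐ (distinguished⇔ (painting r τs))
            (subst (DistinguishedFrom ε (word r)) (sym (tiles-painting τs))
          (⇒ (distinguish-correct (word r) (tiles F r)) (⇒ (antiDistinguished⇔ F) A)))
        where τs = distinguish (word r) (tiles F r)

      fromDeo : Carrier (Deo f P) → Carrier (AntiDeo f P)
      fromDeo (F , h , D) = painting r τs ,
        repaint-permutation F τs (λ i → trans (sym (run-distinguish (word r) τs i))
          (cong (λ υs → to (run (word r) υs) i) back)) h ,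
        ⇐ (antiDistinguished⇔ (painting r τs))
            (subst (AntiDistinguishedWord (word r)) (sym (tiles-painting τs))
          (⇐ (distinguish-correct (word r) τs)
              (subst (DistinguishedFrom ε (word r)) (sym back) (⇒ (distinguished⇔ F) D))))
        where
        τs = undistinguish (word r) (tiles F r)
        back = distinguish-undistinguish (word r) (tiles F r)

      bijection : Bijection (AntiDeo f P) (Deo f P)
      bijection = record
        { to        = toDeo
        ; cong      = λ {x} {y} → toDeo-cong x y
        ; bijective = (λ {x} {y} → toDeo-injective x y) , λ y → fromDeo y , λ {z} → surjective y z
        }
        where
        toDeo-cong : ∀ x y → _≈_ P (proj₁ x) (proj₁ y) → _≈_ P (proj₁ (toDeo x)) (proj₁ (toDeo y))
        toDeo-cong (F , _) (G , _) e b _ =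
          cong (λ τs → paint r (distinguish (word r) τs) b) (tiles-cong F G r e)

        toDeo-injective : ∀ x y → _≈_ P (proj₁ (toDeo x)) (proj₁ (toDeo y)) → _≈_ P (proj₁ x)
            (proj₁ y)
        toDeo-injective x@(F , _) y@(G , _) e = tiles-injective F G (begin
          tiles F r                                                   ≡⟨ undistinguish-distinguish
              (word r) (tiles F r) ⟨
          undistinguish (word r) (distinguish (word r) (tiles F r))   ≡⟨ cong
              (undistinguish (word r)) (begin
            distinguish (word r) (tiles F r)  ≡⟨ tiles-painting _ ⟨
            tiles (proj₁ (toDeo x)) r         ≡⟨ tiles-cong (proj₁ (toDeo x)) (proj₁ (toDeo y)) r e
                ⟩
            tiles (proj₁ (toDeo y)) r         ≡⟨ tiles-painting _ ⟩
            distinguish (word r) (tiles G r)  ∎) ⟩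
          undistinguish (word r) (distinguish (word r) (tiles G r))   ≡⟨ undistinguish-distinguish
              (word r) (tiles G r) ⟩
          tiles G r                                                   ∎)
          where open ≡-Reasoning

        surjective : ∀ y z → _≈_ P (proj₁ z) (proj₁ (fromDeo y)) → _≈_ P (proj₁ (toDeo z)) (proj₁ y)
        surjective y@(G , _) z@(F , _) e = tiles-injective (proj₁ (toDeo z)) G (begin
          tiles (proj₁ (toDeo z)) r                                 ≡⟨ tiles-painting _ ⟩
          distinguish (word r) (tiles F r)                          ≡⟨ cong (distinguish (word r))
              (trans
            (tiles-cong F (proj₁ (fromDeo y)) r e) (tiles-painting _)) ⟩
          distinguish (word r) (undistinguish (word r) (tiles G r)) ≡⟨ distinguish-undistinguish
              (word r) (tiles G r) ⟩
          tiles G r ∎)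
          where open ≡-Reasoning

-- The sweep of the strip

module Sweep {n k : ℕ} (1<n : 1 ℕ.< n) .{{_ : NonZero n}} (P : LatticePath k n) where

  open Congruence n
  open Remainder n
  open Words n 1<n
  open Path P
  open Regions 1<n P
  open Strip 1<n P
  open Cut

  Region-resp : ∀ {Q Q₁ Q′} → vtx Q ≗ vtx Q₁ → Region Q₁ Q′ → Region Q Q′
  Region-resp e (done e′) = done λ i → trans (e i) (e′ i)
  Region-resp e (fl ∷ r)  = Flip-resp e fl ∷ r

  flipped-resp : ∀ {Q Q₁ Q′} (e : vtx Q ≗ vtx Q₁) {r : Region Q₁ Q′} {b} →
    Flipped b r → Flipped b (Region-resp {Q} e r)
  flipped-resp e (here {i = i} a e′) = here a (trans e′ (sym (e (i - 1ℤ))))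
  flipped-resp e (there f)           = there f

  _++ᴿ_ : ∀ {Q Q′ Q″} → Region Q Q′ → Region Q′ Q″ → Region Q Q″
  done e   ++ᴿ r′ = Region-resp e r′
  (fl ∷ r) ++ᴿ r′ = fl ∷ (r ++ᴿ r′)

  flipped-++ˡ : ∀ {Q Q′ Q″} {r : Region Q Q′} (r′ : Region Q′ Q″) {b} → Flipped b r → Flipped b
      (r ++ᴿ r′)
  flipped-++ˡ r′ (here a e) = here a e
  flipped-++ˡ r′ (there f)  = there (flipped-++ˡ r′ f)

  flipped-++ʳ : ∀ {Q Q′ Q″} (r : Region Q Q′) {r′ : Region Q′ Q″} {b} → Flipped b r′ → Flipped b
      (r ++ᴿ r′)
  flipped-++ʳ (done e) f = flipped-resp e f
  flipped-++ʳ (fl ∷ r) f = there (flipped-++ʳ r f)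

  -- Raising by s moves a vertex s antidiagonals on; the index i - s compensates for it.
  raised : ℕ → Cut
  raised s = record
    { vtx      = λ i → vertex P (i - + s) ⊕ (0ℤ , + s)
    ; level    = λ i → trans (antidiagonal-⊕ (vertex P (i - + s)) (0ℤ , + s))
                   (trans (cong₂ _+_ (antidiagonal-vertex (i - + s)) (ℤ.+-identityˡ (+ s)))
                       (ring i (+ s)))
    ; periodic = λ i → trans (cong (_⊕ (0ℤ , + s))
                   (trans (cong (vertex P) (ring′ i (+ n) (+ s))) (vertex-shift (i - + s))))
                   (⊕-swap (vertex P (i - + s)) T (0ℤ , + s))
    }
    where
    ring : ∀ i s → i - s + s ≡ i
    ring = solve-∀
    ring′ : ∀ i n s → i + n - s ≡ i - s + n
    ring′ = solve-∀

  -- The starting point of edge i of `raised s`. If that edge is an R-step, the box standing on it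
  -- is the one between `raised s` and `raised (suc s)`.
  corner : ℕ → ℤ → Point
  corner s i = start P (i - + s) ⊕ (0ℤ , + s)

  raised-pred : ∀ s i → vtx (raised s) (i - 1ℤ) ≡ corner s i
  raised-pred s i = cong (λ t → vertex P t ⊕ (0ℤ , + s)) (ring i (+ s))
    where
    ring : ∀ i s → i - 1ℤ - s ≡ i - s - 1ℤ
    ring = solve-∀

  raised-step : ∀ s i → vtx (raised s) i ≡ corner s i ⊕ vec (step P (i - + s))
  raised-step s i = trans (cong (_⊕ (0ℤ , + s)) (vertex-step (i - + s)))
    (⊕-swap (start P (i - + s)) (vec (step P (i - + s))) (0ℤ , + s))

  -- One layer up and one index back: the two translates reach their vertices i from the same
  -- corner, the upper one always by an up-step.
  raised-suc : ∀ s i → vtx (raised (suc s)) i ≡ corner s i ⊕ vec U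
  raised-suc s i = trans (cong (λ t → vertex P t ⊕ (0ℤ , + suc s)) (ring i (+ s)))
    (assoc (start P (i - + s)) (+ s))
    where
    ring : ∀ i s → i - (1ℤ + s) ≡ i - s - 1ℤ
    ring = solve-∀
    ring₀ : ∀ x → x + 0ℤ ≡ x + 0ℤ + 0ℤ
    ring₀ = solve-∀
    ring₁ : ∀ y s → y + (1ℤ + s) ≡ y + s + 1ℤ
    ring₁ = solve-∀
    assoc : ∀ v s → v ⊕ (0ℤ , 1ℤ + s) ≡ v ⊕ (0ℤ , s) ⊕ vec U
    assoc (x , y) s = cong₂ _,_ (ring₀ x) (ring₁ y s)

  edge-raised : ∀ s i → edge (raised s) i ≡ (step P (i - + s) , corner s i)
  edge-raised s i = edge-intro (raised s) i (step P (i - + s)) (raised-pred s i) (raised-step s i)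

  northern-raised : ∀ i → northern P i ≡ edge (raised k) (i + + k)
  northern-raised i = sym (trans (edge-raised k (i + + k))
    (cong (λ t → step P t , start P t ⊕ (0ℤ , + k)) (ring i (+ k))))
    where
    ring : ∀ i k → i + k - k ≡ i
    ring = solve-∀

  southern-raised : ∀ i → southern P i ≡ edge (raised 0) i
  southern-raised i = sym (trans (edge-raised 0 i)
    (trans (cong (step P (i - 0ℤ) ,_) (⊕-identityʳ (start P (i - 0ℤ))))
        (cong (southern P) (ℤ.+-identityʳ i))))

  corner-inside : ∀ s i → s ℕ.< k → step P (i - + s) ≡ R → InStrip P (corner s i)
  corner-inside s i s<k r = record
    { index  = i - + s
    ; isR    = r
    ; column = ℤ.+-identityʳ (proj₁ (start P (i - + s)))
    ; above  = ℤ.i≤i+j (proj₂ (start P (i - + s))) (+ s)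
    ; below  = ℤ.+-monoʳ-< (proj₂ (start P (i - + s))) (+<+ s<k)
    }

  module _ (i₀ : ℤ) (step-i₀ : step P i₀ ≡ U) where

    -- The number of steps along `raised s` since the last copy of the up-step `i₀`.
    offset : ℕ → ℤ → ℕ
    offset s i = (i - + s - i₀) %ℕ n

    offset-≋ : ∀ s i → i - + s ≋ i₀ + + offset s i
    offset-≋ s i = ≋-trans (≋-reflexive (ring (i - + s) i₀))
      (≋-trans (≋-+ i₀ (%ℕ-≋ (i - + s - i₀))) (≋-reflexive (ℤ.+-comm (+ offset s i) i₀)))
      where
      ring : ∀ j i₀ → j ≡ j - i₀ + i₀
      ring = solve-∀

    offset-unique : ∀ s i {t} → t ℕ.< n → i - + s ≋ i₀ + + t → offset s i ≡ t
    offset-unique s i {t} t<n a = ≋⇒%ℕ (≋-trans (≋-+ (- i₀) a) (≋-reflexive (ring i₀ (+ t)))) t<n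
      where
      ring : ∀ i₀ t → i₀ + t - i₀ ≡ t
      ring = solve-∀

    offset-≋⇒ : ∀ s {i j} → i ≋ j → offset s i ≡ offset s j
    offset-≋⇒ s a = %ℕ-cong (≋-+ (- i₀) (≋-+ (- + s) a))

    offset-step : ∀ s i {t} → offset s i ≡ t → step P (i - + s) ≡ step P (i₀ + + t)
    offset-step s i refl = step-≋ (offset-≋ s i)

    offset-zero : ∀ s i → offset s i ≡ 0 → step P (i - + s) ≡ U
    offset-zero s i e = trans (offset-step s i e) (trans (cong (step P) (ℤ.+-identityʳ i₀)) step-i₀)

    offset-class : ∀ s i {t} → offset s i ≡ t → i ≋ i₀ + + t + + s
    offset-class s i refl = ≋-trans (≋-reflexive (ring i (+ s))) (≋-+ (+ s) (offset-≋ s i))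
      where
      ring : ∀ i s → i ≡ i - s + s
      ring = solve-∀

    offset-pred : ∀ s i {t} → suc t ℕ.< n → offset s i ≡ suc t → offset s (i - 1ℤ) ≡ t
    offset-pred s i {t} t+1<n o = offset-unique s (i - 1ℤ) (ℕ.<-trans (ℕ.n<1+n t) t+1<n)
      (≋-trans (≋-reflexive (ring i (+ s))) (≋-trans (≋-+ (- 1ℤ) (offset-≋ s i))
        (≋-reflexive (trans (cong (λ t → i₀ + + t - 1ℤ) o) (ring′ i₀ (+ t))))))
      where
      ring : ∀ i s → i - 1ℤ - s ≡ i - s - 1ℤ
      ring = solve-∀
      ring′ : ∀ i t → i + (1ℤ + t) - 1ℤ ≡ i + t
      ring′ = solve-∀

    raised-coincide : ∀ s i → step P (i - + s) ≡ U → vtx (raised s) i ≡ vtx (raised (suc s)) i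
    raised-coincide s i u = trans (raised-step s i)
      (trans (cong (λ a → corner s i ⊕ vec a) u) (sym (raised-suc s i)))

    -- Lowering the vertices of raised (suc s) one class at a time, starting right
    -- after an up-step, keeps every intermediate sequence of vertices a path.
    between : ℕ → ℕ → Cut
    between s t = record { vtx = v ; level = lev ; periodic = per }
      where
      v : ℤ → Point
      v i = if does (offset s i ℕ.≤? t) then vtx (raised s) i else vtx (raised (suc s)) i
      lev : ∀ i → antidiagonal (v i) ≡ i
      lev i with does (offset s i ℕ.≤? t)
      ... | true  = level (raised s) i
      ... | false = level (raised (suc s)) i
      per : ∀ i → v (i + + n) ≡ v i ⊕ T
      per i rewrite offset-≋⇒ s (≋-period i) with does (offset s i ℕ.≤? t)
      ... | true  = periodic (raised s) i
      ... | false = periodic (raised (suc s)) i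

    between-low : ∀ s t i → offset s i ℕ.≤ t → vtx (between s t) i ≡ vtx (raised s) i
    between-low s t i h = cong (if_then _ else _) (dec-true (offset s i ℕ.≤? t) h)

    between-high : ∀ s t i → t ℕ.< offset s i → vtx (between s t) i ≡ vtx (raised (suc s)) i
    between-high s t i h = cong (if_then _ else _) (dec-false (offset s i ℕ.≤? t) (ℕ.<⇒≱ h))

    between-same : ∀ s t i → offset s i ≢ suc t → vtx (between s (suc t)) i ≡ vtx (between s t) i
    between-same s t i ≢ with ℕ.≤-<-connex (offset s i) t
    ... | inj₁ h = trans (between-low s (suc t) i (ℕ.m≤n⇒m≤1+n h)) (sym (between-low s t i h))
    ... | inj₂ h = trans (between-high s (suc t) i (ℕ.≤∧≢⇒< h (λ e → ≢ (sym e))))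
        (sym (between-high s t i h))

    between-pred : ∀ s i {t} → suc t ℕ.< n → offset s i ≡ suc t →
      vtx (between s t) (i - 1ℤ) ≡ corner s i
    between-pred s i {t} t+1<n o =
      trans (between-low s t (i - 1ℤ) (ℕ.≤-reflexive (offset-pred s i t+1<n o))) (raised-pred s i)

    -- Only offset 0 is lowered, and there the translates coincide because the step is `U`.
    between-start : ∀ s → vtx (raised (suc s)) ≗ vtx (between s 0)
    between-start s i with offset s i in eq
    ... | zero  = sym (raised-coincide s i (offset-zero s i eq))
    ... | suc _ = refl

    between-skip : ∀ {s t} → step P (i₀ + + suc t) ≡ U → vtx (between s t) ≗ vtx (between s (suc t))
    between-skip {s} {t} u i with offset s i ℕ.≟ suc t
    ... | no ≢  = sym (between-same s t i ≢)
    ... | yes e = trans (between-high s t i (ℕ.≤-reflexive (sym e)))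
      (trans (sym (raised-coincide s i (trans (offset-step s i e) u)))
          (sym (between-low s (suc t) i (ℕ.≤-reflexive e))))

    -- The vertex before, at offset t, is already lowered to the corner of the box; the vertex
    -- itself and the one after it still have their upper places, so the cut runs along the left and
    -- top edges.
    between-flip : ∀ {s t} → s ℕ.< k → suc t ℕ.< n → step P (i₀ + + suc t) ≡ R →
      Flip (between s t) (i₀ + + suc t + + s) (between s (suc t))
    between-flip {s} {t} s<k t+1<n r = record
      { up     = λ {i} a → trans (high a) (trans (raised-suc s i) (cong (_⊕ vec U) (sym (pred a))))
      ; across = λ {i} a → trans (next a) (trans (raised-suc s (i + 1ℤ)) (trans
          (cong (_⊕ vec U) (trans (trans (sym (raised-pred s (i + 1ℤ)))
              (cong (vtx (raised s)) (i+1-1 i))) (lowered a)))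
          (trans (⊕-swap (corner s i) (vec R) (vec U))
              (cong (_⊕ vec R) (sym (trans (high a) (raised-suc s i)))))))
      ; pushed = λ {i} a → trans (between-low s (suc t) i (ℕ.≤-reflexive (offset≡ a)))
            (trans (lowered a) (cong (_⊕ vec R) (sym (pred a))))
      ; inside = λ {i} a → subst (InStrip P) (sym (pred a)) (corner-inside s i s<k (isR a))
      ; away   = λ {i} ¬a → between-same s t i (¬a ∘ offset-class s i)
      }
      where
      ring₁ : ∀ j s → j + s - s ≡ j
      ring₁ = solve-∀
      p = i₀ + + suc t + + s
      class : ∀ {i} → i ≋ p → i - + s ≋ i₀ + + suc t
      class a = ≋-trans (≋-+ (- + s) a) (≋-reflexive (ring₁ (i₀ + + suc t) (+ s)))
      offset≡ : ∀ {i} → i ≋ p → offset s i ≡ suc t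
      offset≡ {i} a = offset-unique s i t+1<n (class a)
      isR : ∀ {i} → i ≋ p → step P (i - + s) ≡ R
      isR {i} a = trans (offset-step s i (offset≡ a)) r
      high : ∀ {i} → i ≋ p → vtx (between s t) i ≡ vtx (raised (suc s)) i
      high {i} a = between-high s t i (ℕ.≤-reflexive (sym (offset≡ a)))
      lowered : ∀ {i} → i ≋ p → vtx (raised s) i ≡ corner s i ⊕ vec R
      lowered {i} a = trans (raised-step s i) (cong (λ c → corner s i ⊕ vec c) (isR a))
      pred : ∀ {i} → i ≋ p → vtx (between s t) (i - 1ℤ) ≡ corner s i
      pred {i} a = between-pred s i t+1<n (offset≡ a)
      next : ∀ {i} → i ≋ p → vtx (between s t) (i + 1ℤ) ≡ vtx (raised (suc s)) (i + 1ℤ)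
      next {i} a with suc (suc t) ℕ.<? n
      ... | yes h = between-high s t (i + 1ℤ)
          (ℕ.<-trans (ℕ.n<1+n t) (ℕ.≤-reflexive (sym (offset-unique s (i + 1ℤ) h after))))
        where
        ring₂ : ∀ i s → i + 1ℤ - s ≡ i - s + 1ℤ
        ring₂ = solve-∀
        ring₃ : ∀ i t → i + (1ℤ + t) + 1ℤ ≡ i + (1ℤ + (1ℤ + t))
        ring₃ = solve-∀
        after : i + 1ℤ - + s ≋ i₀ + + suc (suc t)
        after = ≋-trans (≋-reflexive (ring₂ i (+ s)))
            (≋-trans (≋-+ 1ℤ (class a)) (≋-reflexive (ring₃ i₀ (+ t))))
      -- At the last offset the next vertex wraps round to offset 0. It counts as lowered, but at
      -- the up-step both translates share it.
      ... | no ¬h = trans (between-low s t (i + 1ℤ) (subst (ℕ._≤ t) (sym zero-off) ℕ.z≤n))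
                          (raised-coincide s (i + 1ℤ) (offset-zero s (i + 1ℤ) zero-off))
        where
        n≡ : n ≡ suc (suc t)
        n≡ = ℕ.≤-antisym (ℕ.≮⇒≥ ¬h) t+1<n
        ring₂ : ∀ i s → i + 1ℤ - s ≡ i - s + 1ℤ
        ring₂ = solve-∀
        ring₃ : ∀ i t → i + (1ℤ + t) + 1ℤ ≡ i + 0ℤ + (1ℤ + (1ℤ + t))
        ring₃ = solve-∀
        zero-off : offset s (i + 1ℤ) ≡ 0
        zero-off = offset-unique s (i + 1ℤ) (ℕ.<-trans ℕ.z<s 1<n)
          (≋-trans (≋-reflexive (ring₂ i (+ s))) (≋-trans (≋-+ 1ℤ (class a)) (≋-trans (≋-reflexive
            (trans (ring₃ i₀ (+ t)) (cong (λ m → i₀ + 0ℤ + + m) (sym n≡)))) (≋-period (i₀ + 0ℤ)))))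

    Covers : ∀ {Q Q′} → Region Q Q′ → ℕ → ℕ → Set
    Covers r s t = ∀ i → t ℕ.< offset s i → step P (i - + s) ≡ R → Flipped (corner s i) r

    -- `d` counts the offsets still to be lowered; the last one is n - 1.
    layer : ∀ s → s ℕ.< k → ∀ d t → t ℕ.+ suc d ≡ n → ∃[ r ] Covers {between s t} {raised s} r s t
    layer s s<k zero t e = done (λ i → between-low s t i (≤t i)) ,
        λ i t< _ → contradiction (≤t i) (ℕ.<⇒≱ t<)
      where
      ≤t : ∀ i → offset s i ℕ.≤ t
      ≤t i = ℕ.<⇒≤pred (subst (offset s i ℕ.<_) (sym (trans (ℕ.+-comm 1 t) e))
          (n%ℕd<d (i - + s - i₀) n))
    layer s s<k (suc d) t e
      with layer s s<k d (suc t) (trans (sym (ℕ.+-suc t (suc d))) e) | step P (i₀ + + suc t) in eq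
    ... | r , c | U = Region-resp (between-skip eq) r , covers
      where
      covers : Covers (Region-resp {between s t} (between-skip eq) r) s t
      covers i t< isR with offset s i ℕ.≟ suc t
      ... | yes o = contradiction (trans (sym isR) (trans (offset-step s i o) eq)) λ ()
      ... | no ≢  = flipped-resp (between-skip eq) (c i (ℕ.≤∧≢⇒< t< (λ o → ≢ (sym o))) isR)
    ... | r , c | R = between-flip s<k t+1<n eq ∷ r , covers
      where
      t+1<n : suc t ℕ.< n
      t+1<n = subst (suc t ℕ.<_) e (subst (ℕ._< t ℕ.+ suc (suc d)) (ℕ.+-comm t 1)
                (ℕ.+-monoʳ-< t (ℕ.s≤s (ℕ.s≤s ℕ.z≤n))))
      covers : Covers (between-flip s<k t+1<n eq ∷ r) s t
      covers i t< isR with offset s i ℕ.≟ suc t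
      ... | no ≢  = there (c i (ℕ.≤∧≢⇒< t< (λ o → ≢ (sym o))) isR)
      ... | yes o = here {i = i} (offset-class s i o) (sym (between-pred s i t+1<n o))

    descent : ∀ s → s ℕ.≤ k → ∃[ r ] ∀ s′ → s′ ℕ.< s → ∀ i → step P (i - + s′) ≡ R →
      Flipped (corner s′ i) {raised s} {raised 0} r
    descent zero    _    = done (λ _ → refl) , λ _ ()
    descent (suc s) s<k
      with layer s s<k (ℕ.pred n) 0 (ℕ.suc-pred n) | descent s (ℕ.<⇒≤ s<k)
    ... | r , c | r′ , c′ = Region-resp (between-start s) r ++ᴿ r′ , covers
      where
      covers : ∀ s′ → s′ ℕ.< suc s → ∀ i → step P (i - + s′) ≡ R →
        Flipped (corner s′ i) (Region-resp {raised (suc s)} (between-start s) r ++ᴿ r′)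
      covers s′ s′<1+s i isR with s′ ℕ.≟ s
      ... | no ≢     = flipped-++ʳ (Region-resp (between-start s) r)
          (c′ s′ (ℕ.≤∧≢⇒< (ℕ.<⇒≤pred s′<1+s) ≢) i isR)
      -- An R-step never has offset 0, so starting the layer at t = 0 misses no box.
      ... | yes refl = flipped-++ˡ r′ (flipped-resp (between-start s)
            (c i (ℕ.n≢0⇒n>0 λ o → contradiction (trans (sym isR) (offset-zero s i o)) λ ()) isR))

  strip : ∃[ r ] (∀ {b} → InStrip P b → Flipped b {raised k} {raised 0} r)
  strip with Fin.any? (λ t → isU? (lookup (steps P) t))
    where
    isU? : (a : Step) → Dec (a ≡ U)
    isU? R = no λ ()
    isU? U = yes refl
  ... | yes (t , u) = let r , c = descent (+ suc (toℕ t)) (trans (step-lookup t) u) k ℕ.≤-refl in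
      r , λ h → subst (λ b → Flipped b r) (corner≡ h)
          (c (height h) (height<k h) (InStrip.index h + + height h)
              (trans (cong (step P) (index≡ h)) (InStrip.isR h)))
    where
    module _ {b : Point} (h : InStrip P b) where
      open InStrip h
      -- A strip box is located by the R-step below it and its height above that step; the height is
      -- the number of its layer.
      height : ℕ
      height = ∣ proj₂ b - proj₂ (start P index) ∣
      height≡ : + height ≡ proj₂ b - proj₂ (start P index)
      height≡ = ℤ.0≤i⇒+∣i∣≡i (ℤ.i≤j⇒0≤j-i above)
      height<k : height ℕ.< k
      height<k = ℤ.drop‿+<+ (subst₂ _<_ (sym height≡) (ring (proj₂ (start P index)) (+ k))
        (ℤ.+-monoˡ-< (- proj₂ (start P index)) below))
        where
        ring : ∀ y k → y + k - y ≡ k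
        ring = solve-∀
      index≡ : index + + height - + height ≡ index
      index≡ = ring index (+ height)
        where
        ring : ∀ i s → i + s - s ≡ i
        ring = solve-∀
      corner≡ : corner height (index + + height) ≡ b
      corner≡ = trans (cong (λ t → start P t ⊕ (0ℤ , + height)) index≡)
        (cong₂ _,_ (trans (ℤ.+-identityʳ _) (sym column))
          (trans (cong (λ t → proj₂ (start P index) + t) height≡)
              (ring (proj₂ (start P index)) (proj₂ b))))
        where
        ring : ∀ y y′ → y + (y′ - y) ≡ y′
        ring = solve-∀
  -- Without up-steps k = 0, so the two boundaries coincide.
  ... | no ¬u = done (λ i → cong (λ s → vtx (raised s) i) (all-R⇒k≡0 all-R)) ,
      λ h → contradiction h (no-boxes all-R)
    where
    isR : ∀ a → a ≢ U → a ≡ R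
    isR R _ = refl
    isR U h = contradiction refl h
    all-R : ∀ i → step P i ≡ R
    all-R i = isR (step P i) λ u → ¬u (_ , u)

-- The period 1

≮1⇒≡1 : ∀ n .{{_ : NonZero n}} → ¬ 1 ℕ.< n → n ≡ 1
≮1⇒≡1 (suc zero)    _  = refl
≮1⇒≡1 (suc (suc n)) ≮1 = contradiction (ℕ.s≤s (ℕ.s≤s ℕ.z≤n)) ≮1

-- A box stands over an R-step. With one step per period all steps would then be `R`, which forces k
-- = 0 and an empty strip.
no-boxes-of-width-1 : ∀ {k} (P : LatticePath k 1) {b} → ¬ InStrip P b
no-boxes-of-width-1 P h = Path.no-boxes P
  (λ i → trans (Path.step-≋ P {i} {index} (Congruence.by (i - index) (ring i index))) isR) h
  where
  open InStrip h
  ring : ∀ i j → i ≡ j + (i - j) * 1ℤ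
  ring = solve-∀

theorem1p3 : (n k : ℕ) .{{_ : NonZero n}} → k ≤ n →
    (f : AffinePermutation n) → Bounded k n f →
    (P : LatticePath k n) →
    (𝐟 : ReducedWord k f) →
    Bijection (AntiDeo f P) (Deo f P)
theorem1p3 n k _ f _ P _ with 1 ℕ.<? n
... | yes 1<n = Correspondence.bijection (proj₁ strip) (proj₂ strip) f
  where
  open Sweep 1<n P
  open Strip.Boundaries 1<n P (raised k) (raised 0) northern-raised southern-raised
... | no ≮1 with ≮1⇒≡1 n ≮1
-- Without boxes both conditions are vacuous, and every filling is sent to itself.
...   | refl = record
  { to        = λ (F , h , _) → F , h , λ b inside → contradiction inside empty
  ; cong      = λ e → e
  ; bijective = (λ e → e) ,
      λ (F , h , _) → (F , h , λ b inside → contradiction inside empty) , λ e → e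
  }
  where
  empty : ∀ {b} → ¬ InStrip P b
  empty = no-boxes-of-width-1 P
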